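{- Let $n\ge 3$. For every $\xi\in\mathcal{C}(\mathcal{G}_n)$, the number $g_\xi^{(n)}$ of unlabelled graphs $G$ of order $n$ (isomorphism classes of graphs of order $n$) with $|\Gamma(G)|=\xi$ satisfies $$g_\xi^{(n)}=\frac{\xi}{n!}\,|\mathcal{L}_\xi(\mathcal{G}_n)|.$$
   Context: Let $V=\{1,\dots,n\}$ and let $\binom{V}{2}$ be the set of 2-element subsets of $V$; write $ij$ for $\{i,j\}$ with $i<j$. A labelled graph of order $n$ is a pair $G=(V,E)$ with $E\subseteq\binom{V}{2}$; $\mathcal{G}_n$ is the set of all of them. Let $A$ be the symmetric group on $V$. For $\alpha\in A$, $\alpha G$ is the graph on $V$ with edge-set $\{\{\alpha i,\alpha j\}: ij\in E\}$; two labelled graphs $G,H$ are isomorphic if $H=\alpha G$ for some $\alpha\in A$, and $\Gamma(G)=\{\alpha\in A:\alpha G=G\}$ is the automorphism group of $G$. Let $\alpha'$ be the permutation of $\binom{V}{2}$ given by $\alpha'\{i,j\}=\{\alpha i,\alpha j\}$, and let $Z(\alpha')$ be the set of all cycles (including cycles of length 1) in the disjoint cycle decomposition of $\alpha'$. Let $\lambda=\binom{n}{2}$, and for $ij\in\binom{V}{2}$ ($i<j$) let $p_{ij}=\frac{(2n-i)(i-1)}{2}+(j-i)$ and $w(ij)=2^{\lambda-p_{ij}}$. For a cycle $z$ let $W(z)=\sum_{ij\in z}w(ij)$, and define the polynomials $$F_\alpha^{(n)}(x)=\prod_{z\in Z(\alpha')}\bigl(1+x^{W(z)}\bigr)\ (\alpha\in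 A),\qquad F^{(n)}(x)=\sum_{\alpha\in A}F_\alpha^{(n)}(x).$$ Let $c_L$ be the coefficient of $x^L$ in $F^{(n)}(x)$. Put $\mathcal{C}(\mathcal{G}_n)=\{c_L : L\ge 0,\ c_L\neq 0\}$, and for a positive integer $\xi$ put $\mathcal{L}_\xi(\mathcal{G}_n)=\{L : c_L=\xi\}$. -}

module Defs where

open import Level using (0ℓ)
open import Data.Bool.Base using (Bool; true)
open import Data.Bool.Properties using (⇔→≡) renaming (_≟_ to _≟ᵇ_)
open import Data.Empty using (⊥-elim-irr)
open import Data.Fin.Base as Fin using (Fin; zero; suc; toℕ)
import Data.Fin.Properties as Fin
open import Data.Fin.Permutation as Perm using (Permutation′; _⟨$⟩ʳ_)
open import Data.List.Base using
  (List; []; _∷_; [_]; _++_; map; concatMap; filter; foldr; replicate; deduplicate; allFin)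
open import Data.List.Properties using (≡-dec)
open import Data.List.Membership.Propositional using (_∈_; lose; find)
open import Data.List.Membership.Propositional.Properties using (∈-concatMap⁺; ∈-allFin)
open import Data.List.Relation.Unary.Any using (Any; here; any?)
open import Data.Nat.Base using (ℕ; zero; suc; _+_; _*_; _∸_; _^_; _/_)
open import Data.Nat.ListAction using (sum)
open import Data.Nat.Combinatorics using (_C_)
open import Data.Nat.GeneralisedArithmetic using (iterate)
open import Data.Product.Base using (Σ; ∃; _×_; _,_; proj₁)
open import Function.Base using (_∘_)
open import Function.Bundles using (Bijection; mk⇔; Injection; Inverse)
open import Function.Construct.Composition using () renaming (inverse to _⟨∘⟩_)
open import Function.Construct.Symmetry using () renaming (inverse to ⟨sym⟩)
open import Function.Properties.Bijection using (Bijection⇒Inverse)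
open import Function.Properties.Inverse using (↔⇒↣)
open import Relation.Binary.Bundles using (Setoid)
open import Relation.Binary.Definitions using (DecidableEquality; tri<; tri≈; tri>)
import Relation.Binary.Construct.On as On
open import Relation.Binary.PropositionalEquality
  using (_≡_; _≢_; refl; sym; trans; cong; subst; setoid)
open import Relation.Nullary.Decidable
  using (Dec; does; yes; no; map′; _×-dec_; dec-true; recompute)
open import Relation.Nullary.Negation using (contradiction)
open import Relation.Unary using (Pred)

private
  variable
    n : ℕ

HasSize : Setoid 0ℓ 0ℓ → ℕ → Set
HasSize S k = Bijection (setoid (Fin k)) S

HasSize-unique : ∀ {S k l} → HasSize S k → HasSize S l → k ≡ l
HasSize-unique p q =
  Perm.↔⇒≡ (Bijection⇒Inverse p ⟨∘⟩ ⟨sym⟩ (Bijection⇒Inverse q))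

-- The vertex set {1,…,n} is Fin n, where x : Fin n carries this label.
label : Fin n → ℕ
label x = suc (toℕ x)

record Pair (n : ℕ) : Set where
  constructor mkPair
  field
    lo hi  : Fin n
    .lo<hi : lo Fin.< hi

open Pair public

infix 4 _≟ᵖ_

_≟ᵖ_ : DecidableEquality (Pair n)
mkPair i j _ ≟ᵖ mkPair k l _ =
  map′ (λ { (refl , refl) → refl }) (λ { refl → refl , refl })
       (i Fin.≟ k ×-dec j Fin.≟ l)

pair : (i j : Fin n) → .(i ≢ j) → Pair n
pair i j i≢j with Fin.<-cmp i j
... | tri< i<j _ _ = mkPair i j i<j
... | tri≈ _ i≡j _ = ⊥-elim-irr (i≢j i≡j)
... | tri> _ _ j<i = mkPair j i j<i

increasing : (i j : Fin n) → List (Pair n)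
increasing i j with i Fin.<? j
... | yes i<j = [ mkPair i j i<j ]
... | no  _   = []

allPairs : ∀ n → List (Pair n)
allPairs n = concatMap (λ i → concatMap (increasing i) (allFin n)) (allFin n)

lo≢hi : (e : Pair n) → lo e ≢ hi e
lo≢hi (mkPair i j i<j) = Fin.<⇒≢ (recompute (i Fin.<? j) i<j)

perm-≢ : (α : Permutation′ n) {i j : Fin n} → i ≢ j → α ⟨$⟩ʳ i ≢ α ⟨$⟩ʳ j
perm-≢ α i≢j = i≢j ∘ Injection.injective (↔⇒↣ α)

infix 30 _′

_′ : Permutation′ n → Pair n → Pair n
(α ′) e = pair (α ⟨$⟩ʳ lo e) (α ⟨$⟩ʳ hi e) (perm-≢ α (lo≢hi e))

-- A labelled graph is given by the characteristic function of its edge set.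
record Graph (n : ℕ) : Set where
  constructor mkGraph
  field
    edge : Pair n → Bool

open Graph public

infix 4 _∈ᴱ_ _≈ᴳ_ _≅_
infixr 8 _·_

_∈ᴱ_ : Pair n → Graph n → Set
e ∈ᴱ G = edge G e ≡ true

_≈ᴳ_ : Graph n → Graph n → Set
G ≈ᴳ H = ∀ e → edge G e ≡ edge H e

image? : (α : Permutation′ n) (G : Graph n) (e : Pair n) →
         Dec (Any (λ d → d ∈ᴱ G × (α ′) d ≡ e) (allPairs n))
image? {n} α G e = any? (λ d → (edge G d ≟ᵇ true) ×-dec ((α ′) d ≟ᵖ e)) (allPairs n)

_·_ : Permutation′ n → Graph n → Graph n
α · G = mkGraph λ e → does (image? α G e)

_≅_ : Graph n → Graph n → Set
_≅_ {n} G H = ∃ λ (α : Permutation′ n) → H ≈ᴳ α · G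

permSetoid : ℕ → Setoid 0ℓ 0ℓ
permSetoid n = record
  { Carrier       = Permutation′ n
  ; _≈_           = Perm._≈_
  ; isEquivalence = record
    { refl  = λ _ → refl
    ; sym   = λ p i → sym (p i)
    ; trans = λ p q i → trans (p i) (q i)
    }
  }

Γ : Graph n → Setoid 0ℓ 0ℓ
Γ {n} G = On.setoid {B = Σ (Permutation′ n) λ α → α · G ≈ᴳ G} (permSetoid n) proj₁

∈-allPairs : (e : Pair n) → e ∈ allPairs n
∈-allPairs {n} (mkPair i j i<j) =
  ∈-concatMap⁺ _ (lose (∈-allFin i) (∈-concatMap⁺ _ (lose (∈-allFin j) found)))
  where
  found : mkPair i j i<j ∈ increasing i j
  found with i Fin.<? j
  ... | yes _   = here refl
  ... | no  i≮j = contradiction (recompute (i Fin.<? j) i<j) i≮j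

∈-·⁺ : (α : Permutation′ n) (G : Graph n) {d : Pair n} → d ∈ᴱ G → (α ′) d ∈ᴱ α · G
∈-·⁺ α G {d} d∈G = dec-true (image? α G _) (lose (∈-allPairs d) (d∈G , refl))

∈-·⁻ : (α : Permutation′ n) (G : Graph n) {e : Pair n} →
       e ∈ᴱ α · G → ∃ λ d → d ∈ᴱ G × (α ′) d ≡ e
∈-·⁻ α G {e} e∈ with image? α G e
... | yes p with find p
...   | d , _ , q = d , q

pair-lo-hi : (e : Pair n) .(p : lo e ≢ hi e) → pair (lo e) (hi e) p ≡ e
pair-lo-hi (mkPair i j i<j) p with Fin.<-cmp i j
... | tri< _ _ _   = refl
... | tri≈ i≮j _ _ = contradiction (recompute (i Fin.<? j) i<j) i≮j
... | tri> i≮j _ _ = contradiction (recompute (i Fin.<? j) i<j) i≮j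

pair-cong : {i j k l : Fin n} .{p : i ≢ j} .{q : k ≢ l} →
            i ≡ k → j ≡ l → pair i j p ≡ pair k l q
pair-cong refl refl = refl

pair-swap : (i j : Fin n) .{p : i ≢ j} .{q : j ≢ i} → pair i j p ≡ pair j i q
pair-swap i j {p} with Fin.<-cmp i j | Fin.<-cmp j i
... | tri< _ _ _     | tri> _ _ _     = refl
... | tri> _ _ _     | tri< _ _ _     = refl
... | tri≈ _ i≡j _   | _              = ⊥-elim-irr (p i≡j)
... | tri< _ _ _     | tri≈ _ j≡i _   = ⊥-elim-irr (p (sym j≡i))
... | tri> _ _ _     | tri≈ _ j≡i _   = ⊥-elim-irr (p (sym j≡i))
... | tri< i<j _ _   | tri< _ _ i≮j   = contradiction i<j i≮j
... | tri> _ _ j<i   | tri> j≮i _ _   = contradiction j<i j≮i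

′-pair : (α : Permutation′ n) (i j : Fin n) .(p : i ≢ j) .(q : α ⟨$⟩ʳ i ≢ α ⟨$⟩ʳ j) →
         (α ′) (pair i j p) ≡ pair (α ⟨$⟩ʳ i) (α ⟨$⟩ʳ j) q
′-pair α i j p q with Fin.<-cmp i j
... | tri< _ _ _   = refl
... | tri≈ _ i≡j _ = ⊥-elim-irr (p i≡j)
... | tri> _ _ _   = pair-swap (α ⟨$⟩ʳ j) (α ⟨$⟩ʳ i)

′-id : (e : Pair n) → (Perm.id ′) e ≡ e
′-id e = pair-lo-hi e (lo≢hi e)

′-∘ : (α β : Permutation′ n) (e : Pair n) → ((α Perm.∘ₚ β) ′) e ≡ (β ′) ((α ′) e)
′-∘ α β e = sym (′-pair β (α ⟨$⟩ʳ lo e) (α ⟨$⟩ʳ hi e) (perm-≢ α (lo≢hi e)) (perm-≢ β (perm-≢ α (lo≢hi e))))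

′-flip : (α : Permutation′ n) (e : Pair n) → ((Perm.flip α) ′) ((α ′) e) ≡ e
′-flip α e =
  trans (′-pair (Perm.flip α) _ _ _ (λ eq → lo≢hi e (trans (sym (Perm.inverseˡ α)) (trans eq (Perm.inverseˡ α)))))
 (trans (pair-cong (Perm.inverseˡ α) (Perm.inverseˡ α)) (pair-lo-hi e (lo≢hi e)))

≈ᴳ-intro : {G H : Graph n} → (∀ {e} → e ∈ᴱ G → e ∈ᴱ H) → (∀ {e} → e ∈ᴱ H → e ∈ᴱ G) → G ≈ᴳ H
≈ᴳ-intro f g e = ⇔→≡ (mk⇔ f g)

≅-refl : {G : Graph n} → G ≅ G
≅-refl {G = G} = Perm.id , ≈ᴳ-intro
  (λ {e} e∈G → subst (_∈ᴱ Perm.id · G) (′-id e) (∈-·⁺ Perm.id G e∈G))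
  (λ e∈ → let d , d∈G , eq = ∈-·⁻ Perm.id G e∈
          in subst (_∈ᴱ G) (trans (sym (′-id d)) eq) d∈G)

≅-sym : {G H : Graph n} → G ≅ H → H ≅ G
≅-sym {G = G} {H} (α , H≈αG) = Perm.flip α , ≈ᴳ-intro
  (λ {e} e∈G → subst (_∈ᴱ Perm.flip α · H) (′-flip α e)
                 (∈-·⁺ (Perm.flip α) H (trans (H≈αG _) (∈-·⁺ α G e∈G))))
  (λ e∈ → let d , d∈H , eq = ∈-·⁻ (Perm.flip α) H e∈
              c , c∈G , eq′ = ∈-·⁻ α G (trans (sym (H≈αG d)) d∈H)
          in subst (_∈ᴱ G)
               (trans (sym (′-flip α c)) (trans (cong ((Perm.flip α) ′) eq′) eq)) c∈G)

≅-trans : {G H K : Graph n} → G ≅ H → H ≅ K → G ≅ K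
≅-trans {G = G} {H} {K} (α , H≈αG) (β , K≈βH) = α Perm.∘ₚ β , ≈ᴳ-intro
  (λ e∈K → let d , d∈H , eq = ∈-·⁻ β H (trans (sym (K≈βH _)) e∈K)
               c , c∈G , eq′ = ∈-·⁻ α G (trans (sym (H≈αG d)) d∈H)
           in subst (_∈ᴱ (α Perm.∘ₚ β) · G)
                (trans (′-∘ α β c) (trans (cong (β ′) eq′) eq))
                (∈-·⁺ (α Perm.∘ₚ β) G c∈G))
  (λ e∈ → let c , c∈G , eq = ∈-·⁻ (α Perm.∘ₚ β) G e∈
          in trans (K≈βH _) (subst (_∈ᴱ β · H) (trans (sym (′-∘ α β c)) eq)
               (∈-·⁺ β H (trans (H≈αG _) (∈-·⁺ α G c∈G)))))

unlabelled : ℕ → Setoid 0ℓ 0ℓ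
unlabelled n = record
  { Carrier       = Graph n
  ; _≈_           = _≅_
  ; isEquivalence = record
    { refl  = λ {G} → ≅-refl {G = G}
    ; sym   = λ {G} {H} → ≅-sym {G = G} {H}
    ; trans = λ {G} {H} {K} → ≅-trans {G = G} {H} {K}
    }
  }

-- The size of this setoid is g_ξ⁽ⁿ⁾.
unlabelledWithAut : ℕ → ℕ → Setoid 0ℓ 0ℓ
unlabelledWithAut n ξ =
  On.setoid {B = Σ (Graph n) λ G → HasSize (Γ G) ξ} (unlabelled n) proj₁

-- A cycle of a permutation of the n C 2 pairs has length at most n C 2,
-- so the powers below n C 2 reach all of it.
onCycle? : (α : Permutation′ n) (d e : Pair n) →
           Dec (∃ λ (k : Fin (n C 2)) → iterate (α ′) d (toℕ k) ≡ e)
onCycle? α d e = Fin.any? λ k → iterate (α ′) d (toℕ k) ≟ᵖ e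

-- A cycle is represented by its elements, listed in the order of
-- allPairs; hence two cycles are equal as lists iff they are equal.
cycleOf : Permutation′ n → Pair n → List (Pair n)
cycleOf {n} α d = filter (onCycle? α d) (allPairs n)

Z : Permutation′ n → List (List (Pair n))
Z {n} α = deduplicate (≡-dec _≟ᵖ_) (map (cycleOf α) (allPairs n))

-- With i < j ≤ n the subtractions do not truncate and the division is
-- exact; p is the position of ij in the lexicographic order, so that
-- 1 ≤ p ≤ n C 2.
p : Pair n → ℕ
p {n} e = (2 * n ∸ i) * (i ∸ 1) / 2 + (j ∸ i)
  where
  i = label (lo e)
  j = label (hi e)

w : Pair n → ℕ
w {n} e = 2 ^ (n C 2 ∸ p e)

W : List (Pair n) → ℕ
W z = sum (map w z)

-- Polynomials over ℕ are coefficient lists, constant term first.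
Poly : Set
Poly = List ℕ

infixl 6 _+ₚ_
infixl 7 _*ₚ_

_+ₚ_ : Poly → Poly → Poly
[]      +ₚ g       = g
(a ∷ f) +ₚ []      = a ∷ f
(a ∷ f) +ₚ (b ∷ g) = (a + b) ∷ (f +ₚ g)

_*ₚ_ : Poly → Poly → Poly
[]      *ₚ g = []
(a ∷ f) *ₚ g = map (a *_) g +ₚ (0 ∷ (f *ₚ g))

1ₚ : Poly
1ₚ = [ 1 ]

x^_ : ℕ → Poly
x^ k = replicate k 0 ++ [ 1 ]

coeff : Poly → ℕ → ℕ
coeff []      _       = 0
coeff (a ∷ _) zero    = a
coeff (_ ∷ f) (suc L) = coeff f L

∑ₚ ∏ₚ : {A : Set} → List A → (A → Poly) → Poly
∑ₚ xs f = foldr (λ x → f x +ₚ_) [] xs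
∏ₚ xs f = foldr (λ x → f x *ₚ_) 1ₚ xs

-- Each permutation of Fin (suc n) is insert zero j π (zero ↦ j, and π
-- between the remaining points) for exactly one j and one π, so every
-- permutation is listed exactly once up to Perm._≈_.
allPermutations : ∀ n → List (Permutation′ n)
allPermutations zero    = [ Perm.id ]
allPermutations (suc n) =
  concatMap (λ j → map (Perm.insert zero j) (allPermutations n)) (allFin (suc n))

Fₐ : Permutation′ n → Poly
Fₐ α = ∏ₚ (Z α) λ z → 1ₚ +ₚ x^ (W z)

F : ℕ → Poly
F n = ∑ₚ (allPermutations n) Fₐ

c : ℕ → ℕ → ℕ
c n L = coeff (F n) L

𝓒 : ℕ → Pred ℕ 0ℓ
𝓒 n ξ = ∃ λ L → c n L ≢ 0 × c n L ≡ ξ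

𝓛 : ℕ → ℕ → Setoid 0ℓ 0ℓ
𝓛 n ξ = On.setoid {B = Σ ℕ λ L → c n L ≡ ξ} (setoid ℕ) proj₁

{-# OPTIONS --safe #-}

-- The weights w are distinct powers of two, so a labelled graph is
-- determined by the total weight of its edges, its code.  The subsets of
-- Z(α′) are the graphs fixed by α, so the coefficient of x^L in F_α is 1 if
-- L is the code of a graph fixed by α, and 0 otherwise; hence c_L = |Γ(G)|
-- if L is the code of G, and c_L = 0 if L is not a code.  So 𝓛_ξ is the set
-- of codes of the labelled graphs with automorphism group of order ξ.
-- Counting the pairs (R , α) of a representative R of an isomorphism class of
-- such graphs and a permutation α by the graph α R gives g n! = |𝓛_ξ| ξ.
module Submission where

open import Defs

-- The coefficients of `Fₐ α` are 0 or 1 only because different subsets of `Z α` have different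
-- total weights. Since cycles are disjoint, the weight of a subset is the code of the graph formed
-- by its cycles; injectivity of `code` recovers that graph, and with it the subset. Injectivity of
-- `code` in turn rests on `p` being strictly increasing along `allPairs`. Graphs are compared
-- pointwise and permutations by their values, so every cardinality is that of a setoid. It is read
-- off from a list without repetitions up to the equivalence in question, and `HasSize-unique` turns
-- a bijection of setoids into an equation of numbers. Comparing codes also decides `_≈ᴳ_`, which
-- makes filtering and counting possible. The final count uses the numbers of isomorphisms between
-- two graphs instead of orbit sizes, so that no cosets have to be formed.

-- Lexicographic positions of pairs.

module PairCodes where

  open import Data.Bool.Base using (Bool; true; false; if_then_else_)
  open import Data.Fin.Base as Fin using (Fin; toℕ)
  import Data.Fin.Properties as Fin
  open import Data.List.Base using (List; []; _∷_; map; concatMap; allFin)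
  open import Data.List.Relation.Unary.All as All using (All; []; _∷_)
  import Data.List.Relation.Unary.All.Properties as All
  open import Data.List.Relation.Unary.AllPairs as AllPairs using (AllPairs; []; _∷_)
  import Data.List.Relation.Unary.AllPairs.Properties as AllPairs
  open import Data.Nat.Base
  open import Data.Nat.Combinatorics using (_C_; nC1≡n; nCk+nC[k+1]≡[n+1]C[k+1])
  open import Data.Nat.Divisibility using (divides-refl)
  open import Data.Nat.DivMod using (+-distrib-/-∣ʳ; m*n/n≡m)
  open import Data.Nat.ListAction using (sum)
  open import Data.Nat.Properties
  open import Data.Nat.Solver using (module +-*-Solver)
  open import Data.Product.Base using (_,_)
  open import Level using (0ℓ)
  open import Relation.Binary.Core using (Rel)
  open import Relation.Binary.Definitions using (tri<; tri≈; tri>)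
  open import Relation.Binary.PropositionalEquality
  open import Data.Sum.Base using (inj₁; inj₂)
  open import Relation.Nullary.Decidable using (recompute; yes; no)
  open import Relation.Nullary.Negation using (contradiction)

  private variable
    n : ℕ
    A B : Set

  -- The position of the last pair before row a (rows are counted from 0).
  rowStart : ℕ → ℕ → ℕ
  rowStart n a = (2 * n ∸ suc a) * a / 2

  -- Writing the order as `suc a + k` makes the truncated subtractions cancel; `k` is then the
  -- number of pairs in row `a`. The two numerators differ by `k * 2`, so the floor division splits
  -- exactly.
  rowStart-suc′ : ∀ a k → rowStart (suc a + k) (suc a) ≡ rowStart (suc a + k) a + k
  rowStart-suc′ a k = begin
    (2 * (suc a + k) ∸ suc (suc a)) * suc a / 2
      ≡⟨ cong (λ m → (m ∸ suc (suc a)) * suc a / 2) (solve 2 (λ a k → con 2 :* (con 1 :+ a :+ k) := con 2 :+ a :+ (a :+ k :+ k)) refl a k) ⟩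
    (suc (suc a) + (a + k + k) ∸ suc (suc a)) * suc a / 2
      ≡⟨ cong (λ m → m * suc a / 2) (m+n∸m≡n (suc (suc a)) _) ⟩
    (a + k + k) * suc a / 2
      ≡⟨ cong (_/ 2) (solve 2 (λ a k → (a :+ k :+ k) :* (con 1 :+ a) := (con 1 :+ a :+ k :+ k) :* a :+ k :* con 2) refl a k) ⟩
    ((suc a + k + k) * a + k * 2) / 2
      ≡⟨ +-distrib-/-∣ʳ ((suc a + k + k) * a) (divides-refl k) ⟩
    (suc a + k + k) * a / 2 + k * 2 / 2
      ≡⟨ cong₂ _+_ (cong (λ m → m * a / 2) (sym (trans (cong (_∸ suc a) (solve 2 (λ a k → con 2 :* (con 1 :+ a :+ k) := con 1 :+ a :+ (con 1 :+ a :+ k :+ k)) refl a k)) (m+n∸m≡n (suc a) _)))) (m*n/n≡m k 2) ⟩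
    rowStart (suc a + k) a + k ∎
    where
    open ≡-Reasoning
    open +-*-Solver

  rowStart-suc : ∀ {n a} → a < n → rowStart n (suc a) ≡ rowStart n a + (n ∸ suc a)
  rowStart-suc {n} {a} a<n =
    subst (λ m → rowStart m (suc a) ≡ rowStart m a + (n ∸ suc a)) (m+[n∸m]≡n a<n) (rowStart-suc′ a (n ∸ suc a))

  rowStart-mono : ∀ {n a b} → a ≤ b → b ≤ n → rowStart n a ≤ rowStart n b
  rowStart-mono {b = zero} z≤n _ = ≤-refl
  rowStart-mono {n} {a} {suc b} a≤1+b 1+b≤n with m≤n⇒m<n∨m≡n a≤1+b
  ... | inj₂ refl = ≤-refl
  ... | inj₁ (s≤s a≤b) = ≤-trans (rowStart-mono a≤b (<⇒≤ 1+b≤n))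
                           (≤-trans (m≤m+n _ _) (≤-reflexive (sym (rowStart-suc 1+b≤n))))

  triangular : ∀ m → m * suc m / 2 ≡ suc m C 2
  triangular zero    = refl
  triangular (suc m) = begin
    suc m * suc (suc m) / 2            ≡⟨ cong (_/ 2) (solve 1 (λ m → (con 1 :+ m) :* (con 2 :+ m) := m :* (con 1 :+ m) :+ (con 1 :+ m) :* con 2) refl m) ⟩
    (m * suc m + suc m * 2) / 2        ≡⟨ +-distrib-/-∣ʳ (m * suc m) (divides-refl (suc m)) ⟩
    m * suc m / 2 + suc m * 2 / 2      ≡⟨ cong₂ _+_ (triangular m) (m*n/n≡m (suc m) 2) ⟩
    suc m C 2 + suc m                  ≡⟨ +-comm (suc m C 2) (suc m) ⟩
    suc m + suc m C 2                  ≡⟨ cong (_+ suc m C 2) (nC1≡n (suc m)) ⟨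
    suc m C 1 + suc m C 2              ≡⟨ nCk+nC[k+1]≡[n+1]C[k+1] (suc m) 1 ⟩
    suc (suc m) C 2                    ∎
    where
    open ≡-Reasoning
    open +-*-Solver

  -- There is no row `n`; its formal start marks the end of the last row, which bounds all positions
  -- by the number of pairs.
  rowStart-end : ∀ n → rowStart n n ≡ n C 2
  rowStart-end zero    = refl
  rowStart-end (suc m) = trans
    (cong (λ k → k * suc m / 2)
      (trans (cong (_∸ suc (suc m)) (solve 1 (λ m → con 2 :* (con 1 :+ m) := con 2 :+ m :+ m) refl m))
             (m+n∸m≡n (suc (suc m)) m)))
    (triangular m)
    where open +-*-Solver

  -- Row `a` carries the label `suc a`, so `p` unfolds to `rowStart n a` plus the difference of the
  -- endpoints. Together with `p≤rowStart` this places row `a` in the half-open interval from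
  -- `rowStart n a` (excluded) to `rowStart n (suc a)` (included), and these intervals are
  -- consecutive.
  rowStart<p : (e : Pair n) → rowStart n (toℕ (lo e)) < p e
  rowStart<p (mkPair i j i<j) = m<m+n _ (m<n⇒0<n∸m (recompute (i Fin.<? j) i<j))

  p≤rowStart : (e : Pair n) → p e ≤ rowStart n (suc (toℕ (lo e)))
  p≤rowStart {n} (mkPair i j _) = begin
    rowStart n (toℕ i) + (toℕ j ∸ toℕ i) ≤⟨ +-monoʳ-≤ (rowStart n (toℕ i)) (∸-monoˡ-≤ (suc (toℕ i)) (Fin.toℕ<n j)) ⟩
    rowStart n (toℕ i) + (n ∸ suc (toℕ i)) ≡⟨ rowStart-suc (Fin.toℕ<n i) ⟨
    rowStart n (suc (toℕ i)) ∎
    where open ≤-Reasoning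

  p≤λ : (e : Pair n) → p e ≤ n C 2
  p≤λ {n} e = ≤-trans (p≤rowStart e)
    (≤-trans (rowStart-mono (Fin.toℕ<n (lo e)) ≤-refl) (≤-reflexive (rowStart-end n)))

  0<p : (e : Pair n) → 0 < p e
  0<p e = ≤-<-trans z≤n (rowStart<p e)

  p-mono-lo : {d e : Pair n} → lo d Fin.< lo e → p d < p e
  p-mono-lo {d = d} {e} lt = ≤-<-trans (p≤rowStart d)
    (≤-<-trans (rowStart-mono lt (<⇒≤ (Fin.toℕ<n (lo e)))) (rowStart<p e))

  p-mono-hi : {d e : Pair n} → lo d ≡ lo e → hi d Fin.< hi e → p d < p e
  p-mono-hi {n} {d = mkPair i j i<j} {mkPair .i k i<k} refl j<k =
    +-monoʳ-< (rowStart n (toℕ i)) (∸-monoˡ-< j<k (<⇒≤ (recompute (i Fin.<? j) i<j)))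

  p-injective : {d e : Pair n} → p d ≡ p e → d ≡ e
  p-injective {d = d} {e} eq with Fin.<-cmp (lo d) (lo e)
  ... | tri< lt _ _ = contradiction eq (<⇒≢ (p-mono-lo {d = d} {e} lt))
  ... | tri> _ _ gt = contradiction eq (>⇒≢ (p-mono-lo {d = e} {d} gt))
  ... | tri≈ _ eqₗ _ with Fin.<-cmp (hi d) (hi e)
  ...   | tri< lt _ _ = contradiction eq (<⇒≢ (p-mono-hi {d = d} {e} eqₗ lt))
  ...   | tri> _ _ gt = contradiction eq (>⇒≢ (p-mono-hi {d = e} {d} (sym eqₗ) gt))
  -- The proofs of `lo < hi` are irrelevant, so equal endpoints already make the pairs equal.
  p-injective {d = mkPair i j _} {mkPair .i .j _} eq | tri≈ _ refl _ | tri≈ _ refl _ = refl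

  AllPairs-concatMap : ∀ {R : Rel B 0ℓ} {S : Rel A 0ℓ} (f : A → List B) →
    (∀ x → AllPairs R (f x)) → (∀ {x y} → S x y → All (λ a → All (R a) (f y)) (f x)) →
    ∀ {xs} → AllPairs S xs → AllPairs R (concatMap f xs)
  AllPairs-concatMap f within across {xs} sorted =
    AllPairs.concat⁺ (All.map⁺ (All.universal within xs)) (AllPairs.map⁺ (AllPairs.map across sorted))

  All-concatMap : ∀ {P : B → Set} (f : A → List B) → (∀ x → All P (f x)) → ∀ xs → All P (concatMap f xs)
  All-concatMap f all xs = All.concat⁺ (All.map⁺ (All.universal all xs))

  increasing-lo : (i j : Fin n) → All (λ e → lo e ≡ i) (increasing i j)
  increasing-lo i j with i Fin.<? j
  ... | yes _ = refl ∷ []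
  ... | no  _ = []

  increasing-hi : (i j : Fin n) → All (λ e → hi e ≡ j) (increasing i j)
  increasing-hi i j with i Fin.<? j
  ... | yes _ = refl ∷ []
  ... | no  _ = []

  increasing-sorted : {R : Rel (Pair n) 0ℓ} (i j : Fin n) → AllPairs R (increasing i j)
  increasing-sorted i j with i Fin.<? j
  ... | yes _ = [] ∷ []
  ... | no  _ = []

  allFin-sorted : ∀ n → AllPairs Fin._<_ (allFin n)
  allFin-sorted n = AllPairs.tabulate⁺-< (λ lt → lt)

  -- Increasing positions mean decreasing binary places, the order in which digits can be compared
  -- from the leading one down.
  allPairs-sorted : ∀ n → AllPairs (λ d e → p d < p e) (allPairs n)
  allPairs-sorted n = AllPairs-concatMap _ row across (allFin-sorted n)
    where
    row : ∀ i → AllPairs (λ d e → p d < p e) (concatMap (increasing i) (allFin n))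
    row i = AllPairs-concatMap _ (increasing-sorted i)
      -- `increasing i j` holds at most the pair `ij`, so within a row the order is that of the
      -- upper endpoints.
      (λ {j} {k} j<k → All.zipWith (λ { {d} (refl , refl) → All.zipWith
         (λ { {e} (lo≡ , refl) → p-mono-hi {d = d} {e} (sym lo≡) j<k }) (increasing-lo i k , increasing-hi i k) })
         (increasing-lo i j , increasing-hi i j))
      (allFin-sorted n)
    row-lo : ∀ i → All (λ e → lo e ≡ i) (concatMap (increasing i) (allFin n))
    row-lo i = All-concatMap (increasing i) (increasing-lo i) (allFin n)
    across : ∀ {i j} → i Fin.< j → All (λ d → All (λ e → p d < p e) (concatMap (increasing j) (allFin n)))
                                        (concatMap (increasing i) (allFin n))
    across {i} {j} i<j = All.map (λ { {d} refl → All.map (λ { {e} refl → p-mono-lo {d = d} {e} i<j }) (row-lo j) }) (row-lo i)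

  pos : Pair n → ℕ
  pos {n} e = n C 2 ∸ p e

  pos<λ : (e : Pair n) → pos e < n C 2
  pos<λ e = ∸-monoʳ-< (0<p e) (p≤λ e)

  pos-injective : {d e : Pair n} → pos d ≡ pos e → d ≡ e
  pos-injective {d = d} {e} eq = p-injective (∸-cancelˡ-≡ (p≤λ d) (p≤λ e) eq)

  -- Finite sums, binary expansions and codes.

  ∑ : List A → (A → ℕ) → ℕ
  ∑ xs f = sum (map f xs)

  ∑-cong : ∀ {xs : List A} {f g : A → ℕ} → All (λ x → f x ≡ g x) xs → ∑ xs f ≡ ∑ xs g
  ∑-cong []         = refl
  ∑-cong (eq ∷ eqs) = cong₂ _+_ eq (∑-cong eqs)

  ∑-+ : ∀ (xs : List A) (f g : A → ℕ) → ∑ xs (λ x → f x + g x) ≡ ∑ xs f + ∑ xs g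
  ∑-+ []       f g = refl
  ∑-+ (x ∷ xs) f g = trans (cong (f x + g x +_) (∑-+ xs f g))
    (solve 4 (λ a b c d → a :+ b :+ (c :+ d) := a :+ c :+ (b :+ d)) refl (f x) (g x) (∑ xs f) (∑ xs g))
    where open +-*-Solver

  module _ (f : A → ℕ) where

    -- When the places `f x` are distinct, this is the number with binary digit `P x` at place
    -- `f x`.
    binary : (A → Bool) → List A → ℕ
    binary P xs = ∑ xs λ x → if P x then 2 ^ f x else 0

    -- A geometric series: the tail stays below `2 ^ f x`, so adding the head stays below its
    -- double, and `suc (f x) ≤ m`.
    binary-bound : ∀ P {m xs} → AllPairs (λ x y → f y < f x) xs → All (λ x → f x < m) xs → binary P xs < 2 ^ m
    binary-bound P {m} [] [] = m^n>0 2 m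
    binary-bound P {m} {x ∷ xs} (x> ∷ sorted) (x<m ∷ _) = begin-strict
      (if P x then 2 ^ f x else 0) + binary P xs <⟨ +-mono-≤-< (head (P x)) (binary-bound P sorted x>) ⟩
      2 ^ f x + 2 ^ f x                         ≡⟨ cong (2 ^ f x +_) (+-identityʳ _) ⟨
      2 ^ suc (f x)                             ≤⟨ ^-monoʳ-≤ 2 x<m ⟩
      2 ^ m                                     ∎
      where
      open ≤-Reasoning
      head : ∀ b → (if b then 2 ^ f x else 0) ≤ 2 ^ f x
      head true  = ≤-refl
      head false = z≤n

    -- The leading digits agree: if only one of the sums contains `2 ^ f x`, it is at least that
    -- large, while the other lies below it by `binary-bound`. Equal leading digits cancel.
    binary-injective : ∀ P Q {xs} → AllPairs (λ x y → f y < f x) xs → binary P xs ≡ binary Q xs →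
                       All (λ x → P x ≡ Q x) xs
    binary-injective P Q [] eq = []
    binary-injective P Q {x ∷ xs} (x> ∷ sorted) eq with P x in Px | Q x in Qx
    ... | true  | true  = trans Px (sym Qx) ∷ binary-injective P Q sorted (+-cancelˡ-≡ (2 ^ f x) _ _ eq)
    ... | false | false = trans Px (sym Qx) ∷ binary-injective P Q sorted eq
    ... | true  | false = contradiction (≤-trans (m≤m+n (2 ^ f x) _) (≤-reflexive eq)) (<⇒≱ (binary-bound Q sorted x>))
    ... | false | true  = contradiction (≤-trans (m≤m+n (2 ^ f x) _) (≤-reflexive (sym eq))) (<⇒≱ (binary-bound P sorted x>))

  code : Graph n → ℕ
  code {n} G = binary pos (edge G) (allPairs n)

  code-injective : {G H : Graph n} → code G ≡ code H → G ≈ᴳ H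
  code-injective {n} {G} {H} eq e = All.lookup
    (binary-injective pos (edge G) (edge H)
      (AllPairs.map (λ {d} {e} lt → ∸-monoʳ-< lt (p≤λ e)) (allPairs-sorted n)) eq)
    (∈-allPairs e)

  code-cong : {G H : Graph n} → G ≈ᴳ H → code G ≡ code H
  code-cong {n} G≈H = ∑-cong (All.universal (λ e → cong (if_then 2 ^ pos e else 0) (G≈H e)) (allPairs n))

-- Coefficients of `Fₐ` and the graphs fixed by a permutation.

module CycleSums where

  open PairCodes
  open import Data.Bool.Base using (Bool; true; false; if_then_else_; _∨_; _∧_; not)
  open import Data.Fin.Base as Fin using (Fin; toℕ; fromℕ<)
  import Data.Fin.Properties as Fin
  open import Data.Fin.Permutation as Perm using (Permutation′)
  open import Data.List.Base using (List; []; _∷_; [_]; _++_; map; filter)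
  open import Data.List.Properties using (≡-dec; filter-≐; map-++; map-∘)
  open import Data.List.Relation.Unary.All as All using (All; []; _∷_)
  open import Data.List.Relation.Unary.All.Properties using (¬Any⇒All¬; All¬⇒¬Any)
  open import Data.List.Relation.Unary.Any as Any using (Any; here; there)
  open import Data.List.Relation.Unary.AllPairs as AllPairs using (AllPairs; []; _∷_)
  import Data.List.Relation.Unary.Unique.Propositional.Properties as Unique
  import Data.List.Relation.Unary.Unique.DecPropositional.Properties as DecUnique
  open import Data.List.Relation.Unary.Unique.Propositional using (Unique)
  open import Data.List.Membership.Propositional using (_∈_; _∉_)
  open import Data.List.Membership.DecPropositional using () renaming (_∈?_ to member?)
  open import Data.List.Membership.Propositional.Properties
  open import Data.Nat.Base
  open import Data.Nat.Combinatorics using (_C_)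
  open import Data.Nat.DivMod using (_/_; _%_; m≡m%n+[m/n]*n; m%n<n)
  open import Data.Nat.GeneralisedArithmetic using (iterate)
  open import Data.Nat.ListAction using (sum)
  open import Data.Nat.ListAction.Properties using (sum-++)
  open import Data.Nat.Properties
  open import Data.Nat.Solver using (module +-*-Solver)
  open import Data.Product.Base using (_,_; proj₂; ∃; _×_)
  open import Data.Sum.Base using (inj₁; inj₂)
  open import Function.Base using (_∘_; case_of_)
  open import Function.Bundles using (mk⇔)
  open import Relation.Binary.PropositionalEquality hiding ([_])
  open import Relation.Nullary.Decidable using (Dec; yes; no; does; dec-true; dec-false; does-⇔; map′)
  open import Relation.Nullary.Negation using (¬_; contradiction)

  private variable
    n : ℕ
    A : Set

  does⁻ : ∀ {P : Set} (P? : Dec P) → does P? ≡ true → P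
  does⁻ (yes p) _ = p

  ⟦_⟧ : Bool → ℕ
  ⟦ b ⟧ = if b then 1 else 0

  module _ {P : A → Set} (P? : ∀ x → Dec (P x)) where

    ∑-none : ∀ {xs} → All (λ x → ¬ P x) xs → ∑ xs (λ x → ⟦ does (P? x) ⟧) ≡ 0
    ∑-none [] = refl
    ∑-none {x ∷ xs} (¬px ∷ ¬pxs) rewrite dec-false (P? x) ¬px = ∑-none ¬pxs

    -- Turns existence and uniqueness into a count. It serves for the subset sums equal to a code,
    -- for the image of a graph under a permutation and for the representative of a class.
    ∑-one : ∀ {xs} → AllPairs (λ x y → P x → ¬ P y) xs → Any P xs → ∑ xs (λ x → ⟦ does (P? x) ⟧) ≡ 1
    ∑-one {x ∷ xs} (x≁ ∷ _) (here px) rewrite dec-true (P? x) px = cong suc (∑-none (All.map (λ f → f px) x≁))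
    ∑-one {x ∷ xs} (x≁ ∷ ps) (there pxs)
      rewrite dec-false (P? x) (λ px → All¬⇒¬Any (All.map (λ f → f px) x≁) pxs) = ∑-one ps pxs

    sum-filter : ∀ (f : A → ℕ) xs → sum (map f (filter P? xs)) ≡ ∑ xs (λ x → if does (P? x) then f x else 0)
    sum-filter f [] = refl
    sum-filter f (x ∷ xs) with does (P? x)
    ... | true  = cong (f x +_) (sum-filter f xs)
    ... | false = sum-filter f xs

  ∑-++ : ∀ (xs ys : List A) f → ∑ (xs ++ ys) f ≡ ∑ xs f + ∑ ys f
  ∑-++ xs ys f = trans (cong sum (map-++ f xs ys)) (sum-++ (map f xs) (map f ys))

  ∑-zero : ∀ (xs : List A) → ∑ xs (λ _ → 0) ≡ 0
  ∑-zero []       = refl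
  ∑-zero (_ ∷ xs) = ∑-zero xs

  -- Coefficients of a product of binomials as numbers of subset sums.

  occurrences : ℕ → List ℕ → ℕ
  occurrences L xs = ∑ xs λ x → ⟦ does (x ≟ L) ⟧

  coeff-+ₚ : ∀ f g L → coeff (f +ₚ g) L ≡ coeff f L + coeff g L
  coeff-+ₚ []      g       L       = refl
  coeff-+ₚ (a ∷ f) []      L       = sym (+-identityʳ _)
  coeff-+ₚ (a ∷ f) (b ∷ g) zero    = refl
  coeff-+ₚ (a ∷ f) (b ∷ g) (suc L) = coeff-+ₚ f g L

  coeff-map : ∀ a g L → coeff (map (a *_) g) L ≡ a * coeff g L
  coeff-map a []      L       = sym (*-zeroʳ a)
  coeff-map a (b ∷ g) zero    = refl
  coeff-map a (b ∷ g) (suc L) = coeff-map a g L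

  coeff-∷-*ₚ : ∀ a f g L → coeff ((a ∷ f) *ₚ g) L ≡ a * coeff g L + coeff (0 ∷ f *ₚ g) L
  coeff-∷-*ₚ a f g L = trans (coeff-+ₚ (map (a *_) g) _ L) (cong (_+ coeff (0 ∷ f *ₚ g) L) (coeff-map a g L))

  coeff-*ₚ-distribʳ : ∀ f h g L → coeff ((f +ₚ h) *ₚ g) L ≡ coeff (f *ₚ g) L + coeff (h *ₚ g) L
  coeff-*ₚ-distribʳ []      h       g L = refl
  coeff-*ₚ-distribʳ (a ∷ f) []      g L = sym (+-identityʳ _)
  coeff-*ₚ-distribʳ (a ∷ f) (b ∷ h) g L = begin
    coeff (((a + b) ∷ (f +ₚ h)) *ₚ g) L                                       ≡⟨ coeff-∷-*ₚ (a + b) (f +ₚ h) g L ⟩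
    (a + b) * coeff g L + coeff (0 ∷ (f +ₚ h) *ₚ g) L                         ≡⟨ cong ((a + b) * coeff g L +_) (tails L) ⟩
    (a + b) * coeff g L + (coeff (0 ∷ f *ₚ g) L + coeff (0 ∷ h *ₚ g) L)
      ≡⟨ solve 5 (λ a b c x y → (a :+ b) :* c :+ (x :+ y) := a :* c :+ x :+ (b :* c :+ y)) refl a b (coeff g L) (coeff (0 ∷ f *ₚ g) L) _ ⟩
    (a * coeff g L + coeff (0 ∷ f *ₚ g) L) + (b * coeff g L + coeff (0 ∷ h *ₚ g) L)
      ≡⟨ cong₂ _+_ (coeff-∷-*ₚ a f g L) (coeff-∷-*ₚ b h g L) ⟨
    coeff ((a ∷ f) *ₚ g) L + coeff ((b ∷ h) *ₚ g) L                           ∎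
    where
    open ≡-Reasoning
    open +-*-Solver
    tails : ∀ L → coeff (0 ∷ (f +ₚ h) *ₚ g) L ≡ coeff (0 ∷ f *ₚ g) L + coeff (0 ∷ h *ₚ g) L
    tails zero    = refl
    tails (suc L) = coeff-*ₚ-distribʳ f h g L

  module _ {g : Poly} {s : List ℕ} (g-counts : ∀ L → coeff g L ≡ occurrences L s) where

    -- The test `k + x ≟ L` replaces a shift of `L` by `k`: it is false by computation once `L` is
    -- exhausted, and one factor of x cancels on both sides by computation.
    coeff-x^-*ₚ : ∀ k L → coeff ((x^ k) *ₚ g) L ≡ ∑ s λ x → ⟦ does (k + x ≟ L) ⟧
    coeff-x^-*ₚ zero L = begin
      coeff ((1 ∷ []) *ₚ g) L          ≡⟨ coeff-∷-*ₚ 1 [] g L ⟩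
      1 * coeff g L + coeff (0 ∷ []) L ≡⟨ cong₂ _+_ (*-identityˡ _) (const-zero L) ⟩
      coeff g L + 0                    ≡⟨ +-identityʳ _ ⟩
      coeff g L                        ≡⟨ g-counts L ⟩
      occurrences L s                  ∎
      where
      open ≡-Reasoning
      const-zero : ∀ L → coeff (0 ∷ []) L ≡ 0
      const-zero zero    = refl
      const-zero (suc L) = refl
    coeff-x^-*ₚ (suc k) zero    = trans (coeff-∷-*ₚ 0 (x^ k) g zero) (sym (∑-zero s))
    coeff-x^-*ₚ (suc k) (suc L) = trans (coeff-∷-*ₚ 0 (x^ k) g (suc L)) (coeff-x^-*ₚ k L)

    coeff-[1+x^]-*ₚ : ∀ k L → coeff ((1ₚ +ₚ x^ k) *ₚ g) L ≡ occurrences L (s ++ map (k +_) s)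
    coeff-[1+x^]-*ₚ k L = begin
      coeff ((1ₚ +ₚ x^ k) *ₚ g) L                           ≡⟨ coeff-*ₚ-distribʳ 1ₚ (x^ k) g L ⟩
      -- `1ₚ` unfolds to `x^ 0`, so one lemma covers both summands.
      coeff ((x^ 0) *ₚ g) L + coeff ((x^ k) *ₚ g) L         ≡⟨ cong₂ _+_ (coeff-x^-*ₚ 0 L) (coeff-x^-*ₚ k L) ⟩
      occurrences L s + ∑ s (λ x → ⟦ does (k + x ≟ L) ⟧)    ≡⟨ cong (occurrences L s +_) (cong sum (map-∘ s)) ⟩
      occurrences L s + occurrences L (map (k +_) s)        ≡⟨ ∑-++ s (map (k +_) s) _ ⟨
      occurrences L (s ++ map (k +_) s)                     ∎
      where open ≡-Reasoning

  -- Expanding the product chooses 1 or the power of x in each factor; the list keeps one entry for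
  -- each choice, so repetitions matter.
  subsetSums : List (List (Pair n)) → List ℕ
  subsetSums []       = [ 0 ]
  subsetSums (z ∷ zs) = subsetSums zs ++ map (W z +_) (subsetSums zs)

  coeff-∏ₚ : ∀ (zs : List (List (Pair n))) L →
             coeff (∏ₚ zs λ z → 1ₚ +ₚ x^ (W z)) L ≡ occurrences L (subsetSums zs)
  coeff-∏ₚ []       zero    = refl
  coeff-∏ₚ []       (suc L) = refl
  coeff-∏ₚ (z ∷ zs) L       = coeff-[1+x^]-*ₚ {s = subsetSums zs} (coeff-∏ₚ zs) (W z) L

  coeff-∑ₚ : ∀ (xs : List A) (f : A → Poly) L → coeff (∑ₚ xs f) L ≡ ∑ xs λ x → coeff (f x) L
  coeff-∑ₚ []       f L = refl
  coeff-∑ₚ (x ∷ xs) f L = trans (coeff-+ₚ (f x) _ L) (cong (coeff (f x) L +_) (coeff-∑ₚ xs f L))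

  -- Iterates and periods.

  iterate-+ : ∀ (f : A → A) x j k → iterate f x (j + k) ≡ iterate f (iterate f x j) k
  iterate-+ f x zero    k = refl
  iterate-+ f x (suc j) k = iterate-+ f (f x) j k

  iterate-suc : ∀ (f : A → A) x k → iterate f x (suc k) ≡ f (iterate f x k)
  iterate-suc f x zero    = refl
  iterate-suc f x (suc k) = iterate-suc f (f x) k

  iterate-period : ∀ (f : A → A) {x} r q → iterate f x r ≡ x → iterate f x (q * r) ≡ x
  iterate-period f r zero    eq = refl
  iterate-period f {x} r (suc q) eq =
    trans (iterate-+ f x r (q * r)) (trans (cong (λ y → iterate f y (q * r)) eq) (iterate-period f r q eq))

  iterate-% : ∀ (f : A → A) {x} r k → iterate f x (suc r) ≡ x → iterate f x (k % suc r) ≡ iterate f x k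
  iterate-% f {x} r k period = begin
    iterate f x (k % suc r)                               ≡⟨ cong (λ y → iterate f y (k % suc r)) (iterate-period f (suc r) (k / suc r) period) ⟨
    iterate f (iterate f x (k / suc r * suc r)) (k % suc r) ≡⟨ iterate-+ f x (k / suc r * suc r) (k % suc r) ⟨
    iterate f x (k / suc r * suc r + k % suc r)           ≡⟨ cong (iterate f x) (trans (m≡m%n+[m/n]*n k (suc r)) (+-comm (k % suc r) _)) ⟨
    iterate f x k                                         ∎
    where open ≡-Reasoning

  iterate-injective : ∀ {f : A → A} → (∀ {x y} → f x ≡ f y → x ≡ y) →
                      ∀ k {x y} → iterate f x k ≡ iterate f y k → x ≡ y
  iterate-injective inj zero    eq = eq
  iterate-injective inj (suc k) eq = inj (iterate-injective inj k eq)

  -- Operations on graphs, their codes, and the action of permutations.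

  _∪_ _∖_ : Graph n → Graph n → Graph n
  G ∪ H = mkGraph λ e → edge G e ∨ edge H e
  G ∖ H = mkGraph λ e → edge G e ∧ not (edge H e)

  code-∪ : (G H : Graph n) → (∀ {e} → e ∈ᴱ H → edge G e ≡ false) → code (G ∪ H) ≡ code H + code G
  code-∪ {n} G H disjoint = trans
    (∑-cong (All.universal (λ e → split e (edge G e) (edge H e) disjoint) (allPairs n)))
    (∑-+ (allPairs n) _ _)
    where
    split : ∀ e g h → (h ≡ true → g ≡ false) →
            (if g ∨ h then w e else 0) ≡ (if h then w e else 0) + (if g then w e else 0)
    split e true  true  d = case d refl of λ ()
    split e true  false d = refl
    split e false true  d = sym (+-identityʳ _)
    split e false false d = refl

  ∖-∪ : (G H : Graph n) → (∀ {e} → e ∈ᴱ H → e ∈ᴱ G) → (G ∖ H) ∪ H ≈ᴳ G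
  ∖-∪ G H H⊆G e = go (edge G e) (edge H e) H⊆G
    where
    go : ∀ g h → (h ≡ true → g ≡ true) → (g ∧ not h) ∨ h ≡ g
    go true  true  _ = refl
    go true  false _ = refl
    go false true  f = sym (f refl)
    go false false _ = refl

  ∖-disjoint : (G H : Graph n) → ∀ {e} → e ∈ᴱ H → edge (G ∖ H) e ≡ false
  ∖-disjoint G H {e} e∈H with edge G e | edge H e
  ... | true  | true = refl
  ... | false | true = refl

  code-empty : (G : Graph n) → (∀ {e} → ¬ e ∈ᴱ G) → code G ≡ 0
  code-empty {n} G empty = trans
    (∑-cong (All.universal (λ e → go (edge G e) empty) (allPairs n))) (∑-zero (allPairs n))
    where
    go : ∀ {k} b → ¬ (b ≡ true) → (if b then k else 0) ≡ 0
    go true  f = contradiction refl f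
    go false f = refl

  -- Equivalent to H ≈ᴳ α · G, without the search in the definition of _·_.
  record Maps {n} (α : Permutation′ n) (G H : Graph n) : Set where
    constructor mkMaps
    field
      edge-′ : ∀ e → edge H ((α ′) e) ≡ edge G e

  open Maps public

  ′-injective : (α : Permutation′ n) → ∀ {d e} → (α ′) d ≡ (α ′) e → d ≡ e
  ′-injective α {d} {e} eq = trans (sym (′-flip α d)) (trans (cong ((Perm.flip α) ′) eq) (′-flip α e))

  ·-Maps : (α : Permutation′ n) (G : Graph n) → Maps α G (α · G)
  ·-Maps {n} α G = mkMaps go
    where
    go : ∀ e → edge (α · G) ((α ′) e) ≡ edge G e
    go e with edge G e in Ge | edge (α · G) ((α ′) e) in αGe
    ... | true  | true  = refl
    ... | false | false = refl
    ... | true  | false = trans (sym αGe) (∈-·⁺ α G Ge)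
    -- The search in `α · G` returns some preimage of `(α ′) e`; injectivity of `α ′` identifies it
    -- with `e`.
    ... | false | true  with d , d∈G , eq ← ∈-·⁻ α G αGe =
      trans (sym d∈G) (trans (cong (edge G) (′-injective α eq)) Ge)

  Maps⇒≈ᴳ : ∀ {α : Permutation′ n} {G H} → Maps α G H → H ≈ᴳ α · G
  Maps⇒≈ᴳ {α = α} {G} {H} maps e = begin
    edge H e                                   ≡⟨ cong (edge H) (′-flip (Perm.flip α) e) ⟨
    edge H ((α ′) (((Perm.flip α) ′) e))       ≡⟨ edge-′ maps _ ⟩
    edge G (((Perm.flip α) ′) e)               ≡⟨ edge-′ (·-Maps α G) _ ⟨
    edge (α · G) ((α ′) (((Perm.flip α) ′) e)) ≡⟨ cong (edge (α · G)) (′-flip (Perm.flip α) e) ⟩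
    edge (α · G) e                             ∎
    where open ≡-Reasoning

  ≈ᴳ⇒Maps : ∀ {α : Permutation′ n} {G H} → H ≈ᴳ α · G → Maps α G H
  ≈ᴳ⇒Maps {α = α} {G} H≈αG = mkMaps λ e → trans (H≈αG _) (edge-′ (·-Maps α G) e)

  infix 4 _≈ᴳ?_

  _≈ᴳ?_ : (G H : Graph n) → Dec (G ≈ᴳ H)
  G ≈ᴳ? H = map′ code-injective code-cong (code G ≟ code H)

  maps? : (α : Permutation′ n) (G H : Graph n) → Dec (Maps α G H)
  maps? α G H = map′ ≈ᴳ⇒Maps Maps⇒≈ᴳ (H ≈ᴳ? α · G)

  -- Makes the pigeonhole principle applicable to pairs.
  index : Pair n → Fin (n C 2)
  index e = fromℕ< (pos<λ e)

  index-injective : {d e : Pair n} → index d ≡ index e → d ≡ e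
  index-injective {d = d} {e} eq = pos-injective
    (Fin.fromℕ<-injective (pos d) (pos e) (pos<λ d) (pos<λ e) eq)

  -- Cycles of the induced permutation of pairs.

  module _ (α : Permutation′ n) where

    private
      σ : Pair n → Pair n
      σ = α ′

    OnCycle : Pair n → Pair n → Set
    OnCycle d e = ∃ λ (k : Fin (n C 2)) → iterate σ d (toℕ k) ≡ e

    -- Injectivity cancels the first `i` steps, so a repetition becomes a return to the starting
    -- point.
    repetition⇒period : ∀ {d i j} → i < j → iterate σ d i ≡ iterate σ d j →
                        ∃ λ r → suc r ≤ j × iterate σ d (suc r) ≡ d
    repetition⇒period {d} {i} {j} i<j eq =
      r , ≤-trans (m≤n+m (suc r) i) (≤-reflexive j≡) , iterate-injective (′-injective α) i (begin
        iterate σ (iterate σ d (suc r)) i ≡⟨ iterate-+ σ d (suc r) i ⟨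
        iterate σ d (suc r + i)           ≡⟨ cong (iterate σ d) (trans (+-comm (suc r) i) j≡) ⟩
        iterate σ d j                     ≡⟨ eq ⟨
        iterate σ d i                     ∎)
      where
      open ≡-Reasoning
      r : ℕ
      r = j ∸ suc i
      j≡ : i + suc r ≡ j
      j≡ = trans (+-suc i r) (m+[n∸m]≡n i<j)

    -- Among the first `n C 2 + 1` iterates two coincide, so a return occurs within `n C 2` steps.
    period : ∀ d → ∃ λ r → suc r ≤ n C 2 × iterate σ d (suc r) ≡ d
    period d =
      let i , j , i<j , eq = Fin.pigeonhole (n<1+n (n C 2)) (λ k → index (iterate σ d (toℕ k)))
          r , r<j , period-r = repetition⇒period i<j (index-injective eq)
      in r , ≤-trans r<j (s≤s⁻¹ (Fin.toℕ<n j)) , period-r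

    -- Lifts the bound on exponents built into `onCycle?`: the exponent is reduced modulo a return
    -- time of at most `n C 2`.
    iterate⇒OnCycle : ∀ {d e} k → iterate σ d k ≡ e → OnCycle d e
    iterate⇒OnCycle {d} {e} k eq =
      let r , r≤λ , period-r = period d
          k%r<λ = <-≤-trans (m%n<n k (suc r)) r≤λ
      in fromℕ< k%r<λ , trans (cong (iterate σ d) (Fin.toℕ-fromℕ< k%r<λ))
                              (trans (iterate-% σ r k period-r) eq)

    OnCycle-refl : ∀ {d} → OnCycle d d
    OnCycle-refl = iterate⇒OnCycle 0 refl

    OnCycle-step : ∀ {d} → OnCycle d (σ d)
    OnCycle-step = iterate⇒OnCycle 1 refl

    OnCycle-trans : ∀ {d e f} → OnCycle d e → OnCycle e f → OnCycle d f
    OnCycle-trans {d} (j , refl) (k , refl) = iterate⇒OnCycle (toℕ j + toℕ k) (iterate-+ σ d (toℕ j) (toℕ k))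

    OnCycle-sym : ∀ {d e} → OnCycle d e → OnCycle e d
    OnCycle-sym {d} (k , refl) =
      let r , _ , period-r = period d
      -- After `k` steps, another `k * r` complete `k` rounds of the return time `suc r`.
      in iterate⇒OnCycle (toℕ k * r) (begin
        iterate σ (iterate σ d (toℕ k)) (toℕ k * r) ≡⟨ iterate-+ σ d (toℕ k) (toℕ k * r) ⟨
        iterate σ d (toℕ k + toℕ k * r)             ≡⟨ cong (iterate σ d) (*-suc (toℕ k) r) ⟨
        iterate σ d (toℕ k * suc r)                 ≡⟨ iterate-period σ (suc r) (toℕ k) period-r ⟩
        d                                           ∎)
      where open ≡-Reasoning

    cycleOf-cong : ∀ {d e} → OnCycle d e → cycleOf α d ≡ cycleOf α e
    cycleOf-cong {d} {e} de = filter-≐ (onCycle? α d) (onCycle? α e)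
      (OnCycle-trans (OnCycle-sym de) , OnCycle-trans de) (allPairs n)

    cycleOf-injective : ∀ {d e} → cycleOf α d ≡ cycleOf α e → OnCycle d e
    cycleOf-injective {d} {e} eq = proj₂ (∈-filter⁻ (onCycle? α d) {xs = allPairs n}
      (subst (e ∈_) (sym eq) (∈-filter⁺ (onCycle? α e) (∈-allPairs e) OnCycle-refl)))

    -- Reading a cycle as a graph turns its weight into a code, so that `code-injective` applies to
    -- sums of cycle weights.
    cycleGraph : Pair n → Graph n
    cycleGraph d = mkGraph λ e → does (onCycle? α d e)

    W-cycleOf : ∀ d → W (cycleOf α d) ≡ code (cycleGraph d)
    W-cycleOf d = sum-filter (onCycle? α d) w (allPairs n)

    cycleGraph-fixed : ∀ d → Maps α (cycleGraph d) (cycleGraph d)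
    cycleGraph-fixed d = mkMaps λ e → does-⇔ (mk⇔ (λ r → OnCycle-trans r (OnCycle-sym OnCycle-step)) (λ r → OnCycle-trans r OnCycle-step))
      (onCycle? α d (σ e)) (onCycle? α d e)

    fixed-constant : ∀ {G} → Maps α G G → ∀ {d e} → OnCycle d e → edge G e ≡ edge G d
    fixed-constant {G} fixed {d} (k , refl) = go (toℕ k) d
      where
      go : ∀ k d → edge G (iterate σ d k) ≡ edge G d
      go zero    d = refl
      go (suc k) d = trans (go k (σ d)) (edge-′ fixed d)

    IsCycle : List (Pair n) → Set
    IsCycle z = ∃ λ d → z ≡ cycleOf α d

    -- The invariant for inductions over a list of cycles: a fixed graph covered by `zs` is a union
    -- of cycles from `zs`. For `Z α` every graph satisfies it.
    CoveredBy : List (List (Pair n)) → Graph n → Set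
    CoveredBy zs G = ∀ {e} → e ∈ᴱ G → cycleOf α e ∈ zs

    disjoint-cycle : ∀ {zs d} {G : Graph n} → cycleOf α d ∉ zs → CoveredBy zs G → ∀ {e} → e ∈ᴱ cycleGraph d → edge G e ≡ false
    disjoint-cycle {zs} {d} {G} d∉zs covered {e} e∈ with edge G e in Ge
    ... | false = refl
    ... | true  = contradiction (subst (_∈ zs) (sym (cycleOf-cong (does⁻ (onCycle? α d e) e∈))) (covered Ge)) d∉zs

    -- The graph is the union of the chosen cycles. A new cycle is not in `zs`, hence disjoint from
    -- a graph covered by `zs`, and the codes add.
    subsetSums-sound : ∀ {zs s} → All IsCycle zs → Unique zs → s ∈ subsetSums zs →
                       ∃ λ G → code G ≡ s × Maps α G G × CoveredBy zs G
    subsetSums-sound [] [] (here refl) =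
      mkGraph (λ _ → false) , code-empty {n} (mkGraph (λ _ → false)) (λ ()) , mkMaps (λ _ → refl) , λ ()
    subsetSums-sound {z ∷ zs} (cyc ∷ cycs) (z∉ ∷ uniq) s∈ with ∈-++⁻ (subsetSums zs) s∈
    ... | inj₁ s∈ˡ with G , eq , fixed , covered ← subsetSums-sound cycs uniq s∈ˡ =
      G , eq , fixed , there ∘ covered
    subsetSums-sound {z ∷ zs} ((d , refl) ∷ cycs) (z∉ ∷ uniq) s∈ | inj₂ s∈ʳ
      with t , t∈ , refl ← ∈-map⁻ (W z +_) s∈ʳ
      with G , refl , fixed , covered ← subsetSums-sound cycs uniq t∈ =
      G ∪ cycleGraph d ,
      trans (code-∪ G (cycleGraph d) (disjoint-cycle {G = G} (All¬⇒¬Any z∉) covered)) (cong (_+ code G) (sym (W-cycleOf d))) ,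
      mkMaps (λ e → cong₂ _∨_ (edge-′ fixed e) (edge-′ (cycleGraph-fixed d) e)) ,
      covered′
      where
      covered′ : CoveredBy (z ∷ zs) (G ∪ cycleGraph d)
      covered′ {e} e∈ with edge G e in Ge
      ... | true  = there (covered Ge)
      ... | false = here (sym (cycleOf-cong (does⁻ (onCycle? α d e) e∈)))

    -- A fixed graph contains the whole cycle of `d` or misses it, as the single edge `d` decides.
    -- If it contains the cycle, removing it leaves a fixed graph covered by the remaining cycles.
    subsetSums-complete : ∀ {zs G} → All IsCycle zs → Maps α G G → CoveredBy zs G → code G ∈ subsetSums zs
    subsetSums-complete {[]} {G} [] fixed covered = here (code-empty G (λ e∈ → case covered e∈ of λ ()))
    subsetSums-complete {z ∷ zs} {G} ((d , refl) ∷ cycs) fixed covered with edge G d in Gd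
    ... | false = ∈-++⁺ˡ (subsetSums-complete cycs fixed covered′)
      where
      covered′ : CoveredBy zs G
      covered′ e∈ with covered e∈
      ... | there ∈zs = ∈zs
      ... | here eq   = case trans (sym e∈) (trans (fixed-constant fixed (cycleOf-injective (sym eq))) Gd) of λ ()
    ... | true  = ∈-++⁺ʳ (subsetSums zs) (subst (_∈ map (W z +_) (subsetSums zs)) code-split
                    (∈-map⁺ (W z +_) (subsetSums-complete cycs fixed′ covered′)))
      where
      H : Graph n
      H = G ∖ cycleGraph d
      cycle⊆G : ∀ {e} → e ∈ᴱ cycleGraph d → e ∈ᴱ G
      cycle⊆G {e} e∈ = trans (fixed-constant fixed (does⁻ (onCycle? α d e) e∈)) Gd
      code-split : W z + code H ≡ code G
      code-split = trans (cong (_+ code H) (W-cycleOf d))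
        (trans (sym (code-∪ H (cycleGraph d) (∖-disjoint G (cycleGraph d))))
               (code-cong (∖-∪ G (cycleGraph d) cycle⊆G)))
      fixed′ : Maps α H H
      fixed′ = mkMaps λ e → cong₂ (λ g h → g ∧ not h) (edge-′ fixed e) (edge-′ (cycleGraph-fixed d) e)
      covered′ : CoveredBy zs H
      covered′ {e} e∈ with edge G e in Ge | onCycle? α d e
      ... | true | no ¬on with covered Ge
      ...   | there ∈zs = ∈zs
      ...   | here eq   = contradiction (cycleOf-injective (sym eq)) ¬on

    -- A value common to both halves would be the code of a graph covered by `zs` and also of a
    -- graph with the edge `d`. Equal codes give equal graphs, so the cycle of `d` would lie in
    -- `zs`.
    subsetSums-unique : ∀ {zs} → All IsCycle zs → Unique zs → Unique (subsetSums zs)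
    subsetSums-unique [] [] = [] ∷ []
    subsetSums-unique {z ∷ zs} ((d , refl) ∷ cycs) (z∉ ∷ uniq) =
      Unique.++⁺ ih (Unique.map⁺ (+-cancelˡ-≡ (W z) _ _) ih) disjoint
      where
      ih : Unique (subsetSums zs)
      ih = subsetSums-unique cycs uniq
      disjoint : ∀ {s} → ¬ (s ∈ subsetSums zs × s ∈ map (W z +_) (subsetSums zs))
      disjoint (s∈ˡ , s∈ʳ)
        with t , t∈ , refl ← ∈-map⁻ (W z +_) s∈ʳ
        with G , eq , _ , coveredG ← subsetSums-sound cycs uniq s∈ˡ
        with H , refl , _ , coveredH ← subsetSums-sound cycs uniq t∈ =
        All¬⇒¬Any z∉ (coveredG (trans (G≈H∪z d) d∈H∪z))
        where
        G≈H∪z : G ≈ᴳ H ∪ cycleGraph d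
        G≈H∪z = code-injective (trans eq (sym (trans
          (code-∪ H (cycleGraph d) (disjoint-cycle {G = H} (All¬⇒¬Any z∉) coveredH))
          (cong (_+ code H) (sym (W-cycleOf d))))))
        d∈H∪z : d ∈ᴱ H ∪ cycleGraph d
        d∈H∪z with edge H d
        ... | true  = refl
        ... | false = dec-true (onCycle? α d d) OnCycle-refl

    Z-cycles : All IsCycle (Z α)
    Z-cycles = All.tabulate λ z∈ →
      let d , _ , eq = ∈-map⁻ (cycleOf α) (∈-deduplicate⁻ (≡-dec _≟ᵖ_) (map (cycleOf α) (allPairs n)) z∈) in d , eq

    Z-unique : Unique (Z α)
    Z-unique = DecUnique.deduplicate-! (≡-dec _≟ᵖ_) (map (cycleOf α) (allPairs n))

    Z-covers : ∀ G → CoveredBy (Z α) G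
    Z-covers G {e} _ = ∈-deduplicate⁺ (≡-dec _≟ᵖ_) (∈-map⁺ (cycleOf α) (∈-allPairs e))

    coeff-Fₐ-code : ∀ G → coeff (Fₐ α) (code G) ≡ ⟦ does (maps? α G G) ⟧
    coeff-Fₐ-code G = trans (coeff-∏ₚ (Z α) (code G)) (go (maps? α G G))
      where
      go : (fixed? : Dec (Maps α G G)) → occurrences (code G) (subsetSums (Z α)) ≡ ⟦ does fixed? ⟧
      go (yes fixed) = ∑-one (_≟ code G)
        (AllPairs.map (λ { x≢y refl eq → x≢y (sym eq) }) (subsetSums-unique Z-cycles Z-unique))
        (Any.map sym (subsetSums-complete {G = G} Z-cycles fixed (Z-covers G)))
      go (no ¬fixed) = ∑-none (_≟ code G) (All.tabulate λ { s∈ refl → ¬fixed (fixed s∈) })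
        where
        fixed : code G ∈ subsetSums (Z α) → Maps α G G
        fixed s∈ with H , eq , fixedH , _ ← subsetSums-sound Z-cycles Z-unique s∈ =
          mkMaps λ e → trans (sym (H≈G eq _)) (trans (edge-′ fixedH e) (H≈G eq e))
          where
          H≈G : ∀ {H} → code H ≡ code G → H ≈ᴳ G
          H≈G = code-injective

    coeff-Fₐ≢0 : ∀ {L} → coeff (Fₐ α) L ≢ 0 → ∃ λ G → code G ≡ L
    coeff-Fₐ≢0 {L} ≢0 with member? _≟_ L (subsetSums (Z α))
    ... | yes L∈ with G , eq , _ ← subsetSums-sound Z-cycles Z-unique L∈ = G , eq
    ... | no  L∉ = contradiction
      (trans (coeff-∏ₚ (Z α) L) (∑-none (_≟ L) (All.map (λ L≢x x≡L → L≢x (sym x≡L)) (¬Any⇒All¬ _ L∉)))) ≢0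

  -- The number of isomorphisms from `G` to `H`; on the diagonal, the order of the automorphism
  -- group.
  mapCount : (G H : Graph n) → ℕ
  mapCount {n} G H = ∑ (allPermutations n) λ α → ⟦ does (maps? α G H) ⟧

  c-code : (G : Graph n) → c n (code G) ≡ mapCount G G
  c-code {n} G = trans (coeff-∑ₚ (allPermutations n) Fₐ (code G))
    (∑-cong (All.universal (λ α → coeff-Fₐ-code α G) (allPermutations n)))

  ∑≢0 : ∀ (xs : List A) f → ∑ xs f ≢ 0 → ∃ λ x → f x ≢ 0
  ∑≢0 []       f ≢0 = contradiction refl ≢0
  ∑≢0 (x ∷ xs) f ≢0 with f x ≟ 0
  ... | yes eq = ∑≢0 xs f λ ∑≡0 → ≢0 (cong₂ _+_ eq ∑≡0)
  ... | no  ≢  = x , ≢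

  c≢0⇒code : ∀ {L} → c n L ≢ 0 → ∃ λ (G : Graph n) → code G ≡ L
  c≢0⇒code {n} {L} ≢0 =
    let α , coeff≢0 = ∑≢0 (allPermutations n) _ (≢0 ∘ trans (coeff-∑ₚ (allPermutations n) Fₐ L))
    in coeff-Fₐ≢0 α coeff≢0

-- Counting isomorphisms and isomorphism classes.

module OrbitCounting where

  open CycleSums
  open PairCodes
  open import Level using (0ℓ)
  open import Data.Bool.Base using (true; false)
  open import Data.Fin.Base as Fin using (Fin; zero; suc; punchIn)
  import Data.Fin.Properties as Fin
  open import Data.Fin.Permutation as Perm using (Permutation′; _⟨$⟩ʳ_; _∘ₚ_)
  import Data.Integer.Base as ℤ
  import Data.Integer.Properties as ℤ
  open import Data.List.Base using (List; []; _∷_; map; concatMap; filter; allFin; length; lookup; upTo; deduplicate)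
  open import Data.List.Properties using (length-map; length-++; length-tabulate; map-∘; map-id-local)
  open import Data.List.Relation.Unary.All as All using (All; []; _∷_)
  import Data.List.Relation.Unary.All.Properties as All
  open import Data.List.Relation.Unary.Any as Any using (Any; here; any?)
  import Data.List.Relation.Unary.Any.Properties as Any
  open import Data.List.Relation.Unary.AllPairs as AllPairs using (AllPairs; []; _∷_)
  import Data.List.Relation.Unary.AllPairs.Properties as AllPairs
  import Data.List.Relation.Unary.Unique.Propositional.Properties as Unique
  import Data.List.Relation.Unary.Unique.DecSetoid.Properties as DecSetoidUnique
  open import Data.List.Membership.Propositional using (_∈_; lose; find)
  open import Data.List.Membership.Propositional.Properties
  import Data.List.Membership.Setoid.Properties as Membership
  open import Data.Nat.Base
  open import Data.Nat.Properties
  open import Data.Product.Base using (Σ; _,_; proj₁; proj₂)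
  import Data.Rational.Base as ℚ
  import Data.Rational.Properties as ℚ
  import Data.Rational.Unnormalised.Base as ℚᵘ
  import Data.Rational.Unnormalised.Properties as ℚᵘ
  open import Function.Base using (_∘_)
  open import Function.Bundles using (Bijection; Inverse)
  open import Function.Construct.Composition using (bijection)
  open import Function.Properties.Inverse using (Inverse⇒Bijection)
  open import Relation.Binary.Bundles using (Setoid; DecSetoid)
  import Relation.Binary.Construct.On as On
  open import Relation.Binary.PropositionalEquality hiding ([_])
  open import Relation.Nullary.Decidable using (Dec; yes; no; does; map′)
  open import Relation.Nullary.Negation using (¬_; contradiction)

  private variable
    n : ℕ
    A B : Set

  ∑-const : ∀ (xs : List A) k → ∑ xs (λ _ → k) ≡ length xs * k
  ∑-const []       k = refl
  ∑-const (_ ∷ xs) k = cong (k +_) (∑-const xs k)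

  ∑-*ʳ : ∀ (xs : List A) f k → ∑ xs (λ x → f x * k) ≡ ∑ xs f * k
  ∑-*ʳ []       f k = refl
  ∑-*ʳ (x ∷ xs) f k = trans (cong (f x * k +_) (∑-*ʳ xs f k)) (sym (*-distribʳ-+ k (f x) (∑ xs f)))

  ∑-swap : ∀ (xs : List A) (ys : List B) (f : A → B → ℕ) → ∑ xs (λ x → ∑ ys (f x)) ≡ ∑ ys (λ y → ∑ xs λ x → f x y)
  ∑-swap []       ys f = sym (∑-zero ys)
  ∑-swap (x ∷ xs) ys f = trans (cong (∑ ys (f x) +_) (∑-swap xs ys f)) (sym (∑-+ ys (f x) _))

  length-filter : ∀ {P : A → Set} (P? : ∀ x → Dec (P x)) xs → length (filter P? xs) ≡ ∑ xs λ x → ⟦ does (P? x) ⟧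
  length-filter P? [] = refl
  length-filter P? (x ∷ xs) with does (P? x)
  ... | true  = cong suc (length-filter P? xs)
  ... | false = length-filter P? xs

  length-concatMap-map : ∀ {C : Set} (f : A → B → C) xs ys →
                         length (concatMap (λ x → map (f x) ys) xs) ≡ length xs * length ys
  length-concatMap-map f []       ys = refl
  length-concatMap-map f (x ∷ xs) ys =
    trans (length-++ (map (f x) ys)) (cong₂ _+_ (length-map (f x) ys) (length-concatMap-map f xs ys))

  -- Sizes of setoids from lists without repetitions.

  module _ (S : Setoid 0ℓ 0ℓ) where

    open Setoid S using (Carrier; _≈_; _≉_) renaming (sym to ≈-sym)

    Sub : (Carrier → Set) → Setoid 0ℓ 0ℓ
    Sub P = On.setoid {B = Σ Carrier P} S proj₁

    lookup-injective : ∀ {xs} → AllPairs _≉_ xs → ∀ i j → lookup xs i ≈ lookup xs j → i ≡ j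
    lookup-injective (_ ∷ _)    zero    zero    eq = refl
    lookup-injective (x≉ ∷ _)   zero    (suc j) eq = contradiction eq (All.lookup x≉ (∈-lookup j))
    lookup-injective (x≉ ∷ _)   (suc i) zero    eq = contradiction (≈-sym eq) (All.lookup x≉ (∈-lookup i))
    lookup-injective (_ ∷ uniq) (suc i) (suc j) eq = cong suc (lookup-injective uniq i j eq)

    HasSize-length : ∀ {P xs} → All P xs → AllPairs _≉_ xs → (∀ {a} → P a → Any (a ≈_) xs) →
                     HasSize (Sub P) (length xs)
    HasSize-length {P} {xs} all unique complete = record
      { to        = λ i → lookup xs i , All.lookup all (∈-lookup i)
      ; cong      = λ { refl → Setoid.refl S }
      ; bijective = lookup-injective unique _ _
                  , λ (a , pa) → Any.index (complete pa) , λ { refl → ≈-sym (Any.lookup-index (complete pa)) }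
      }

    -- `P` defines the setoid to be measured, while `Q` is an equivalent form that can be decided,
    -- such as `Maps α G G` in place of `α · G ≈ᴳ G`.
    HasSize-filter : ∀ {P Q : Carrier → Set} {xs} (Q? : ∀ a → Dec (Q a)) → (∀ {a b} → a ≈ b → Q a → Q b) →
                     (∀ {a} → Q a → P a) → (∀ {a} → P a → Q a) →
                     AllPairs _≉_ xs → (∀ a → Any (a ≈_) xs) →
                     HasSize (Sub P) (∑ xs λ a → ⟦ does (Q? a) ⟧)
    HasSize-filter {P} {xs = xs} Q? resp Q⇒P P⇒Q unique complete =
      subst (HasSize (Sub P)) (length-filter Q? xs)
        (HasSize-length (All.map Q⇒P (All.all-filter Q? xs)) (AllPairs.filter⁺ Q? unique)
          λ {a} pa → Membership.∈-filter⁺ S Q? resp (complete a) (P⇒Q pa))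

  -- The list of all permutations.

  insert-cong : ∀ j {π ρ : Permutation′ n} → π Perm.≈ ρ → Perm.insert zero j π Perm.≈ Perm.insert zero j ρ
  insert-cong j         π≈ρ zero    = refl
  insert-cong j {π} {ρ} π≈ρ (suc k) = trans (Perm.insert-punchIn zero j π k)
    (trans (cong (punchIn j) (π≈ρ k)) (sym (Perm.insert-punchIn zero j ρ k)))

  insert-injective : ∀ j {π ρ : Permutation′ n} → Perm.insert zero j π Perm.≈ Perm.insert zero j ρ → π Perm.≈ ρ
  insert-injective j {π} {ρ} eq k = Fin.punchIn-injective j _ _
    (trans (sym (Perm.insert-punchIn zero j π k)) (trans (eq (suc k)) (Perm.insert-punchIn zero j ρ k)))

  allPermutations-unique : ∀ n → AllPairs (λ π ρ → ¬ π Perm.≈ ρ) (allPermutations n)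
  allPermutations-unique zero    = [] ∷ []
  allPermutations-unique (suc n) = AllPairs-concatMap _
    (λ j → AllPairs.map⁺ (AllPairs.map (λ π≉ρ → π≉ρ ∘ insert-injective j) (allPermutations-unique n)))
    -- Permutations from the blocks of `j` and `k` already differ at `zero`.
    (λ j≢k → All.map⁺ (All.universal (λ _ → All.map⁺ (All.universal (λ _ eq → j≢k (eq zero)) (allPermutations n))) (allPermutations n)))
    (Unique.allFin⁺ (suc n))

  allPermutations-complete : (π : Permutation′ n) → Any (π Perm.≈_) (allPermutations n)
  allPermutations-complete {zero}  π = here λ ()
  allPermutations-complete {suc n} π =
    Any.concatMap⁺ _ (lose (∈-allFin j)
      (Any.map⁺ (Any.map
        (λ eq k → trans (sym (Perm.insert-remove zero π k)) (insert-cong j {Perm.remove zero π} eq k))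
        (allPermutations-complete (Perm.remove zero π)))))
    where
    j : Fin (suc n)
    j = π ⟨$⟩ʳ zero

  length-allPermutations : ∀ n → length (allPermutations n) ≡ n !
  length-allPermutations zero    = refl
  length-allPermutations (suc n) = trans
    (length-concatMap-map (Perm.insert zero) (allFin (suc n)) (allPermutations n))
    (cong₂ _*_ (length-tabulate {n = suc n} (λ i → i)) (length-allPermutations n))

  Maps-resp : ∀ {α β : Permutation′ n} {G H} → α Perm.≈ β → Maps α G H → Maps β G H
  Maps-resp {H = H} α≈β maps = mkMaps λ e →
    trans (cong (edge H) (pair-cong (sym (α≈β (lo e))) (sym (α≈β (hi e))))) (edge-′ maps e)

  Maps-∘ : ∀ {α β : Permutation′ n} {G H K} → Maps α G H → Maps β H K → Maps (α ∘ₚ β) G K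
  Maps-∘ {α = α} {β} {K = K} f g = mkMaps λ e →
    trans (cong (edge K) (′-∘ α β e)) (trans (edge-′ g ((α ′) e)) (edge-′ f e))

  Maps-flip : ∀ {α : Permutation′ n} {G H} → Maps α G H → Maps (Perm.flip α) H G
  Maps-flip {α = α} {H = H} f = mkMaps λ e →
    trans (sym (edge-′ f (((Perm.flip α) ′) e))) (cong (edge H) (′-flip (Perm.flip α) e))

  -- Isomorphisms between two graphs.

  Isos : Graph n → Graph n → Setoid 0ℓ 0ℓ
  Isos {n} G H = Sub (permSetoid n) λ α → Maps α G H

  HasSize-Isos : (G H : Graph n) → HasSize (Isos G H) (mapCount G H)
  HasSize-Isos {n} G H = HasSize-filter (permSetoid n) (λ α → maps? α G H) Maps-resp
    (λ m → m) (λ m → m) (allPermutations-unique n) allPermutations-complete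

  HasSize-Γ : (G : Graph n) → HasSize (Γ G) (mapCount G G)
  HasSize-Γ {n} G = HasSize-filter (permSetoid n) (λ α → maps? α G G) Maps-resp
    (λ fixed e → sym (Maps⇒≈ᴳ fixed e))
    (λ αG≈G → ≈ᴳ⇒Maps (λ e → sym (αG≈G e)))
    (allPermutations-unique n) allPermutations-complete

  module _ {G H : Graph n} {β : Permutation′ n} (maps : Maps β G H) where

    private
      β⁻¹ : Permutation′ n
      β⁻¹ = Perm.flip β

    -- The isomorphisms from `G` to `H` form a torsor under the automorphisms of `G`, which act
    -- before `β`; `precompose` gives the same for those of `H`, acting after `β`.
    postcompose : Inverse (Isos G G) (Isos G H)
    postcompose = record
      { to        = λ (γ , f) → γ ∘ₚ β , Maps-∘ f maps
      ; from      = λ (α , f) → α ∘ₚ β⁻¹ , Maps-∘ f (Maps-flip maps)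
      ; to-cong   = λ eq i → cong (β ⟨$⟩ʳ_) (eq i)
      ; from-cong = λ eq i → cong (β⁻¹ ⟨$⟩ʳ_) (eq i)
      ; inverse   = (λ eq i → trans (cong (β ⟨$⟩ʳ_) (eq i)) (Perm.inverseʳ β))
                  , (λ eq i → trans (cong (β⁻¹ ⟨$⟩ʳ_) (eq i)) (Perm.inverseˡ β))
      }

    precompose : Inverse (Isos H H) (Isos G H)
    precompose = record
      { to        = λ (γ , f) → β ∘ₚ γ , Maps-∘ maps f
      ; from      = λ (α , f) → β⁻¹ ∘ₚ α , Maps-∘ (Maps-flip maps) f
      ; to-cong   = λ eq i → eq (β ⟨$⟩ʳ i)
      ; from-cong = λ eq i → eq (β⁻¹ ⟨$⟩ʳ i)
      ; inverse   = (λ {x} {y} eq i → trans (eq (β ⟨$⟩ʳ i)) (cong (proj₁ x ⟨$⟩ʳ_) (Perm.inverseˡ β)))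
                  , (λ {x} {y} eq i → trans (eq (β⁻¹ ⟨$⟩ʳ i)) (cong (proj₁ x ⟨$⟩ʳ_) (Perm.inverseʳ β)))
      }

    -- Combined with `mapCount-target`, it shows that isomorphic graphs have automorphism groups of
    -- the same order.
    mapCount-source : mapCount G H ≡ mapCount G G
    mapCount-source = HasSize-unique (HasSize-Isos G H) (bijection (HasSize-Isos G G) (Inverse⇒Bijection postcompose))

    mapCount-target : mapCount G H ≡ mapCount H H
    mapCount-target = HasSize-unique (HasSize-Isos G H) (bijection (HasSize-Isos H H) (Inverse⇒Bijection precompose))

  ≈ᴳ⇒≅ : {G H : Graph n} → G ≈ᴳ H → G ≅ H
  ≈ᴳ⇒≅ {G = G} {H} G≈H = Perm.id , Maps⇒≈ᴳ {α = Perm.id} {G} {H}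
    (mkMaps λ e → trans (cong (edge H) (′-id e)) (sym (G≈H e)))

  infix 4 _≅?_

  _≅?_ : (G H : Graph n) → Dec (G ≅ H)
  _≅?_ {n} G H = map′
    (λ some → let α , _ , maps = find some in α , Maps⇒≈ᴳ maps)
    (λ (α , H≈αG) → Any.map (λ α≈β → Maps-resp α≈β (≈ᴳ⇒Maps {α = α} {G} {H} H≈αG)) (allPermutations-complete α))
    (any? (λ α → maps? α G H) (allPermutations n))

  mapCount-≅ : (G H : Graph n) → mapCount G H ≡ ⟦ does (G ≅? H) ⟧ * mapCount H H
  mapCount-≅ {n} G H = go (G ≅? H)
    where
    go : (G≅?H : Dec (G ≅ H)) → mapCount G H ≡ ⟦ does G≅?H ⟧ * mapCount H H
    go (yes (α , H≈αG)) = trans (mapCount-target (≈ᴳ⇒Maps {α = α} {G} {H} H≈αG)) (sym (*-identityˡ _))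
    go (no G≇H) = ∑-none (λ α → maps? α G H)
      (All.universal (λ α maps → G≇H (α , Maps⇒≈ᴳ maps)) (allPermutations n))

  -- Makes the exponents with a given nonzero coefficient a finite, searchable set.
  coeff-length : ∀ f {L} → coeff f L ≢ 0 → L < length f
  coeff-length []      {L}     ≢0 = contradiction refl ≢0
  coeff-length (a ∷ f) {zero}  ≢0 = z<s
  coeff-length (a ∷ f) {suc L} ≢0 = s<s (coeff-length f ≢0)

  unlabelledDec : ℕ → DecSetoid 0ℓ 0ℓ
  unlabelledDec n = record
    { Carrier          = Graph n
    ; _≈_              = _≅_
    ; isDecEquivalence = record
      { isEquivalence = Setoid.isEquivalence (unlabelled n)
      ; _≟_           = _≅?_
      }
    }

  -- Graphs with automorphism group of order `ξ`, and the double count.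

  module _ (n ξ : ℕ) (ξ≢0 : ξ ≢ 0) where

    codes : List ℕ
    codes = filter (λ L → c n L ≟ ξ) (upTo (length (F n)))

    codes-complete : ∀ {L} → c n L ≡ ξ → L ∈ codes
    codes-complete {L} eq =
      ∈-filter⁺ (λ L → c n L ≟ ξ) (∈-upTo⁺ (coeff-length (F n) (ξ≢0 ∘ trans (sym eq)))) eq

    codes-sound : All (λ L → c n L ≡ ξ) codes
    codes-sound = All.all-filter (λ L → c n L ≟ ξ) (upTo (length (F n)))

    codes-unique : AllPairs _≢_ codes
    codes-unique = AllPairs.filter⁺ (λ L → c n L ≟ ξ) (Unique.upTo⁺ (length (F n)))

    HasSize-𝓛 : HasSize (𝓛 n ξ) (length codes)
    HasSize-𝓛 = HasSize-length (setoid ℕ) {xs = codes} codes-sound codes-unique codes-complete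

    graphOf : ℕ → Graph n
    graphOf L with c n L ≟ 0
    -- A dummy value that makes `graphOf` total; it does not occur on `codes`, since `ξ` is nonzero.
    ... | yes _  = mkGraph λ _ → false
    ... | no  ≢0 = proj₁ (c≢0⇒code {n} ≢0)

    code-graphOf : ∀ {L} → c n L ≡ ξ → code (graphOf L) ≡ L
    code-graphOf {L} eq with c n L ≟ 0
    ... | yes ≡0 = contradiction (trans (sym eq) ≡0) ξ≢0
    ... | no  ≢0 = proj₂ (c≢0⇒code {n} ≢0)

    graphs : List (Graph n)
    graphs = map graphOf codes

    -- Carries freedom from repetitions and completeness over from the numbers to the graphs.
    map-code-graphs : map code graphs ≡ codes
    map-code-graphs = trans (sym (map-∘ codes)) (map-id-local (All.map code-graphOf codes-sound))

    graphs-sound : All (λ G → mapCount G G ≡ ξ) graphs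
    graphs-sound = All.map⁺ (All.map
      (λ {L} eq → trans (sym (c-code (graphOf L))) (trans (cong (c n) (code-graphOf eq)) eq)) codes-sound)

    graphs-unique : AllPairs (λ G H → ¬ G ≈ᴳ H) graphs
    graphs-unique = AllPairs.map (λ ≢ → ≢ ∘ code-cong)
      (AllPairs.map⁻ (subst (AllPairs _≢_) (sym map-code-graphs) codes-unique))

    graphs-complete : ∀ {G} → mapCount G G ≡ ξ → Any (G ≈ᴳ_) graphs
    graphs-complete {G} eq = Any.map code-injective
      (Any.map⁻ (subst (code G ∈_) (sym map-code-graphs) (codes-complete (trans (c-code G) eq))))

    classes : List (Graph n)
    classes = deduplicate _≅?_ graphs

    classes⊆graphs : ∀ {G} → G ∈ classes → G ∈ graphs
    classes⊆graphs = ∈-deduplicate⁻ _≅?_ graphs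

    classes-sound : All (λ G → mapCount G G ≡ ξ) classes
    classes-sound = All.tabulate (All.lookup graphs-sound ∘ classes⊆graphs)

    classes-unique : AllPairs (λ G H → ¬ G ≅ H) classes
    classes-unique = DecSetoidUnique.deduplicate-! (unlabelledDec n) graphs

    graphs⇒classes : ∀ {G} → Any (G ≅_) graphs → Any (G ≅_) classes
    graphs⇒classes = Membership.∈-deduplicate⁺ (unlabelled n) _≅?_
      (λ {x} {y} {z} z≅y x≅y → ≅-trans {G = x} {y} {z} x≅y (≅-sym {G = z} {y} z≅y))

    HasAut : Graph n → Set
    HasAut G = HasSize (Γ G) ξ

    classes-HasAut : All HasAut classes
    classes-HasAut = All.map (λ {G} eq → subst (HasSize (Γ G)) eq (HasSize-Γ G)) classes-sound

    classes-complete : ∀ {G} → HasAut G → Any (G ≅_) classes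
    classes-complete {G} size = graphs⇒classes {G} (Any.map (λ {H} → ≈ᴳ⇒≅ {G = G} {H})
      (graphs-complete {G} (HasSize-unique {Γ G} (HasSize-Γ G) size)))

    HasSize-classes : HasSize (unlabelledWithAut n ξ) (length classes)
    HasSize-classes = record { to = to ; cong = to-cong ; bijective = bijective }
      where
      open Bijection (HasSize-length (unlabelled n) {P = HasAut} {xs = classes}
        classes-HasAut classes-unique (λ {G} → classes-complete {G})) renaming (cong to to-cong)

    -- The table of all `mapCount R H` is summed both ways. A row gives `n !`, as each permutation
    -- takes `R` to exactly one listed graph; a column gives `ξ`, as only the representative of the
    -- class of `H` has isomorphisms onto `H`.
    double-count : length classes * n ! ≡ length codes * ξ
    double-count = begin
      length classes * n !                                        ≡⟨ ∑-const classes (n !) ⟨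
      ∑ classes (λ _ → n !)                                       ≡⟨ ∑-cong (All.map orbit classes-sound) ⟨
      ∑ classes (λ R → ∑ graphs (mapCount R))                     ≡⟨ ∑-swap classes graphs mapCount ⟩
      ∑ graphs (λ H → ∑ classes λ R → mapCount R H)               ≡⟨ ∑-cong (All.tabulate fibre) ⟩
      ∑ graphs (λ _ → ξ)                                          ≡⟨ ∑-const graphs ξ ⟩
      length graphs * ξ                                           ≡⟨ cong (_* ξ) (length-map graphOf codes) ⟩
      length codes * ξ                                            ∎
      where
      open ≡-Reasoning
      orbit : ∀ {R} → mapCount R R ≡ ξ → ∑ graphs (mapCount R) ≡ n !
      orbit {R} eq = begin
        ∑ graphs (mapCount R)
          ≡⟨ ∑-swap graphs (allPermutations n) _ ⟩
        ∑ (allPermutations n) (λ α → ∑ graphs λ H → ⟦ does (maps? α R H) ⟧)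
          ≡⟨ ∑-cong (All.universal image (allPermutations n)) ⟩
        ∑ (allPermutations n) (λ _ → 1)
          ≡⟨ ∑-const (allPermutations n) 1 ⟩
        length (allPermutations n) * 1
          ≡⟨ trans (*-identityʳ _) (length-allPermutations n) ⟩
        n ! ∎
        where
        image : ∀ α → ∑ graphs (λ H → ⟦ does (maps? α R H) ⟧) ≡ 1
        image α = ∑-one (maps? α R)
          (AllPairs.map (λ {H} {K} H≉K mH mK → H≉K λ e →
            trans (Maps⇒≈ᴳ mH e) (sym (Maps⇒≈ᴳ mK e))) graphs-unique)
          (Any.map (λ {H} αR≈H → ≈ᴳ⇒Maps (λ e → sym (αR≈H e)))
            -- `α · R` is listed because its automorphism group has the same order as that of `R`.
            (graphs-complete {α · R} (trans (trans (sym (mapCount-target (·-Maps α R)))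
                                                   (mapCount-source (·-Maps α R))) eq)))
      fibre : ∀ {H} → H ∈ graphs → ∑ classes (λ R → mapCount R H) ≡ ξ
      fibre {H} H∈ = begin
        ∑ classes (λ R → mapCount R H)
          ≡⟨ ∑-cong (All.universal (λ R → mapCount-≅ R H) classes) ⟩
        ∑ classes (λ R → ⟦ does (R ≅? H) ⟧ * mapCount H H)
          ≡⟨ ∑-*ʳ classes _ (mapCount H H) ⟩
        ∑ classes (λ R → ⟦ does (R ≅? H) ⟧) * mapCount H H
          ≡⟨ cong₂ _*_ one (All.lookup graphs-sound H∈) ⟩
        1 * ξ
          ≡⟨ *-identityˡ ξ ⟩
        ξ ∎
        where
        one : ∑ classes (λ R → ⟦ does (R ≅? H) ⟧) ≡ 1
        one = ∑-one (_≅? H)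
          (AllPairs.map (λ {R} {S} R≇S R≅H S≅H → R≇S (≅-trans {G = R} {H} {S} R≅H (≅-sym {G = S} {H} S≅H))) classes-unique)
          (Any.map (λ {R} H≅R → ≅-sym {G = H} {R} H≅R)
            (graphs⇒classes (lose H∈ (≅-refl {G = H}))))

  -- Among unnormalised fractions equality is cross multiplication, so the hypothesis applies
  -- without regard to common factors.
  cross-multiply : ∀ g ℓ ξ N .{{_ : NonZero N}} → g * N ≡ ℓ * ξ →
                   ℤ.+ g ℚ./ 1 ≡ (ℤ.+ ξ ℚ./ N) ℚ.* (ℤ.+ ℓ ℚ./ 1)
  cross-multiply g ℓ ξ (suc m) eq = ℚ.toℚᵘ-injective (begin
    ℚ.toℚᵘ (ℤ.+ g ℚ./ 1)                              ≈⟨ ℚ.toℚᵘ-fromℚᵘ (ℚᵘ.mkℚᵘ (ℤ.+ g) 0) ⟩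
    ℚᵘ.mkℚᵘ (ℤ.+ g) 0                                 ≈⟨ ℚᵘ.*≡* cross ⟩
    ℚᵘ.mkℚᵘ (ℤ.+ ξ) m ℚᵘ.* ℚᵘ.mkℚᵘ (ℤ.+ ℓ) 0
      ≈⟨ ℚᵘ.*-cong (ℚ.toℚᵘ-fromℚᵘ (ℚᵘ.mkℚᵘ (ℤ.+ ξ) m)) (ℚ.toℚᵘ-fromℚᵘ (ℚᵘ.mkℚᵘ (ℤ.+ ℓ) 0)) ⟨
    ℚ.toℚᵘ (ℤ.+ ξ ℚ./ suc m) ℚᵘ.* ℚ.toℚᵘ (ℤ.+ ℓ ℚ./ 1)  ≈⟨ ℚ.toℚᵘ-homo-* (ℤ.+ ξ ℚ./ suc m) (ℤ.+ ℓ ℚ./ 1) ⟨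
    ℚ.toℚᵘ ((ℤ.+ ξ ℚ./ suc m) ℚ.* (ℤ.+ ℓ ℚ./ 1))        ∎)
    where
    open import Relation.Binary.Reasoning.Setoid ℚᵘ.≃-setoid
    cross : ℤ.+ g ℤ.* ℤ.+ (suc m * 1) ≡ (ℤ.+ ξ ℤ.* ℤ.+ ℓ) ℤ.* ℤ.+ 1
    cross = trans (sym (ℤ.pos-* g (suc m * 1))) (trans (cong ℤ.+_ lemma)
      (trans (ℤ.pos-* (ξ * ℓ) 1) (cong (ℤ._* ℤ.+ 1) (ℤ.pos-* ξ ℓ))))
      where
      lemma : g * (suc m * 1) ≡ ξ * ℓ * 1
      lemma = trans (cong (g *_) (*-identityʳ (suc m))) (trans eq (trans (*-comm ℓ ξ) (sym (*-identityʳ _))))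

open import Data.Integer.Base using (+_)
open import Data.List.Base using (length)
open import Data.Nat.Base using (ℕ; _≤_; _!)
open import Data.Nat.Properties using (_!≢0)
open import Data.Product.Base using (∃₂; _×_; _,_)
open import Data.Rational.Base using (ℚ; _/_; _*_)
open import Relation.Binary.PropositionalEquality using (_≡_; refl)
open import Relation.Unary using (_∈_)
open OrbitCounting using (classes; codes; HasSize-classes; HasSize-𝓛; double-count; cross-multiply)

theorem7 : ∀ (n : ℕ) → 3 ≤ n →
    ∀ (ξ : ℕ) → ξ ∈ 𝓒 n →
    ∃₂ λ (g ℓ : ℕ) →
    HasSize (unlabelledWithAut n ξ) g ×
    HasSize (𝓛 n ξ) ℓ ×
    + g / 1 ≡ ((+ ξ / n !) {{n !≢0}}) * (+ ℓ / 1)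
-- Matching `refl` identifies `ξ` with a nonzero coefficient, so `c≢0` is the proof that `ξ` is
-- nonzero.
theorem7 n _ ξ (_ , c≢0 , refl) =
  length (classes n ξ c≢0) , length (codes n ξ c≢0) ,
  HasSize-classes n ξ c≢0 , HasSize-𝓛 n ξ c≢0 ,
  cross-multiply (length (classes n ξ c≢0)) (length (codes n ξ c≢0)) ξ (n !) {{n !≢0}}
    (double-count n ξ c≢0)
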